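{- For every positive integer $n$, \[ \mathrm{B}_n=\frac{1}{e}\sum_{k=1}^{n}(-1)^{n-k}\,S(n,k)\,k!\;{}_1F_1(k+1;2;1). \]
   Context: $\mathrm{B}_n$ denotes the $n$-th Bell number, defined by the generating function $e^{e^x-1}=\sum_{k=0}^\infty \mathrm{B}_k\frac{x^k}{k!}$ (equivalently, $\mathrm{B}_n$ is the number of partitions of an $n$-element set into nonempty blocks). $S(n,k)$ denotes the Stirling number of the second kind, $S(n,k)=\frac{1}{k!}\sum_{i=0}^{k}(-1)^i\binom{k}{i}(k-i)^n$. ${}_1F_1(a;b;z)=\sum_{m=0}^\infty \frac{(a)_m}{(b)_m}\frac{z^m}{m!}$ is Kummer's confluent hypergeometric function, where $(a)_0=1$ and $(a)_m=a(a+1)\cdots(a+m-1)$ for $m\ge1$. -}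

module Defs where

import Data.Integer.Base as ℤ
import Data.Integer.Properties as ℤ
open import Data.Nat.Base as ℕ using (ℕ; zero; suc; _∸_; _!; z≤n; s≤s)
open import Data.Nat.Combinatorics using (_C_)
import Data.Nat.Properties as ℕ
open import Data.Product.Base using (_×_; _,_; ∃-syntax; Σ-syntax; proj₁; proj₂)
open import Data.Rational.Base
open import Data.Rational.Literals using (fromℤ)
open import Data.Rational.Properties
open import Data.Rational.Solver using (module +-*-Solver)
open import Algebra.Definitions.RawSemiring +-*-rawSemiring using (_^_)
open import Relation.Binary.PropositionalEquality
open import Relation.Nullary.Decidable.Core using (yes; no)
open import Relation.Nullary.Negation.Core using (contradiction)

fromℕ : ℕ → ℚ
fromℕ n = fromℤ (ℤ.+ n)

∑< : ℕ → (ℕ → ℚ) → ℚ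
∑< zero    f = 0ℚ
∑< (suc n) f = ∑< n f + f n

syntax ∑< n (λ k → t) = ∑[ k < n ] t

infix 8 1/!_
1/!_ : ℕ → ℚ
1/! k = (1/ fromℕ (k !)) {{k ℕ.!≢0}}

-- Stirling number of the second kind, by its explicit alternating sum.
S : ℕ → ℕ → ℚ
S n k = 1/! k * ∑[ i < suc k ] ((- 1ℚ) ^ i * fromℕ (k C i) * fromℕ ((k ∸ i) ℕ.^ n))

-- Formal power series over ℚ, as their coefficient sequences.
PowerSeries : Set
PowerSeries = ℕ → ℚ

1ₚ : PowerSeries
1ₚ zero    = 1ℚ
1ₚ (suc _) = 0ℚ

infixl 6 _-ₚ_
_-ₚ_ : PowerSeries → PowerSeries → PowerSeries
(f -ₚ g) n = f n - g n

infixl 7 _*ₚ_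
_*ₚ_ : PowerSeries → PowerSeries → PowerSeries
(f *ₚ g) n = ∑[ i < suc n ] (f i * g (n ∸ i))

infixr 8 _^ₚ_
_^ₚ_ : PowerSeries → ℕ → PowerSeries
f ^ₚ zero  = 1ₚ
f ^ₚ suc j = f *ₚ f ^ₚ j

-- Substitution g(f(x)), meaningful when f has constant term 0: then
-- x ^ n does not occur in f ^ j for j > n, so the coefficient of x ^ n in
-- Σ_j g_j f ^ j is a sum over j ≤ n.
infixr 9 _∘ₚ_
_∘ₚ_ : PowerSeries → PowerSeries → PowerSeries
(g ∘ₚ f) n = ∑[ j < suc n ] (g j * (f ^ₚ j) n)

expₚ : PowerSeries
expₚ k = 1/! k

-- Bell number, by the formal generating function
-- exp (exp x - 1) = Σ_n B_n x ^ n / n!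
B : ℕ → ℚ
B n = fromℕ (n !) * (expₚ ∘ₚ (expₚ -ₚ 1ₚ)) n

open +-*-Solver using (solve; _:+_; _:*_; _:-_; :-_; _:=_; con)

module ℚ-Lemmas where
  2ℚ : ℚ
  2ℚ = fromℕ 2

  fromℕ-+ : ∀ m n → fromℕ (m ℕ.+ n) ≡ fromℕ m + fromℕ n
  fromℕ-+ m n = sym (trans
    (/-cong {q₁ = 1} {q₂ = 1} (cong₂ ℤ._+_ (ℤ.*-identityʳ (ℤ.+ m)) (ℤ.*-identityʳ (ℤ.+ n))) refl)
    (↥p/↧p≡p (fromℕ (m ℕ.+ n))))

  fromℕ-suc : ∀ n → fromℕ (suc n) ≡ 1ℚ + fromℕ n
  fromℕ-suc = fromℕ-+ 1

  fromℕ-* : ∀ m n → fromℕ (m ℕ.* n) ≡ fromℕ m * fromℕ n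
  fromℕ-* zero    n = sym (*-zeroˡ (fromℕ n))
  fromℕ-* (suc m) n = begin
    fromℕ (n ℕ.+ m ℕ.* n)               ≡⟨ fromℕ-+ n (m ℕ.* n) ⟩
    fromℕ n + fromℕ (m ℕ.* n)           ≡⟨ cong (fromℕ n +_) (fromℕ-* m n) ⟩
    fromℕ n + fromℕ m * fromℕ n         ≡⟨ solve 2 (λ a b → b :+ a :* b := (con 1ℚ :+ a) :* b) refl (fromℕ m) (fromℕ n) ⟩
    (1ℚ + fromℕ m) * fromℕ n            ≡⟨ cong (_* fromℕ n) (sym (fromℕ-suc m)) ⟩
    fromℕ (suc m) * fromℕ n             ∎
    where open ≡-Reasoning

  fromℕ-mono : ∀ {m n} → m ℕ.≤ n → fromℕ m ≤ fromℕ n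
  fromℕ-mono {m} {n} m≤n = *≤* (subst₂ ℤ._≤_ (sym (ℤ.*-identityʳ (ℤ.+ m))) (sym (ℤ.*-identityʳ (ℤ.+ n))) (ℤ.+≤+ m≤n))

  0≤fromℕ : ∀ n → 0ℚ ≤ fromℕ n
  0≤fromℕ n = fromℕ-mono z≤n

  0<fromℕ-suc : ∀ n → 0ℚ < fromℕ (suc n)
  0<fromℕ-suc n = positive⁻¹ (fromℕ (suc n))

  0≤p+q : ∀ {p q} → 0ℚ ≤ p → 0ℚ ≤ q → 0ℚ ≤ p + q
  0≤p+q = +-mono-≤

  0≤p*q : ∀ {p q} → 0ℚ ≤ p → 0ℚ ≤ q → 0ℚ ≤ p * q
  0≤p*q {p} {q} 0≤p 0≤q = nonNegative⁻¹ (p * q)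
    {{nonNeg*nonNeg⇒nonNeg p {{nonNegative 0≤p}} q {{nonNegative 0≤q}}}}

  0<p*q : ∀ {p q} → 0ℚ < p → 0ℚ < q → 0ℚ < p * q
  0<p*q {p} {q} 0<p 0<q = positive⁻¹ (p * q) {{pos*pos⇒pos p {{positive 0<p}} q {{positive 0<q}}}}

  *-mono-≤ : ∀ {p q r s} → 0ℚ ≤ q → 0ℚ ≤ r → p ≤ q → r ≤ s → p * r ≤ q * s
  *-mono-≤ {p} {q} {r} {s} 0≤q 0≤r p≤q r≤s = ≤-trans
    (*-monoʳ-≤-nonNeg r {{nonNegative 0≤r}} p≤q)
    (*-monoˡ-≤-nonNeg q {{nonNegative 0≤q}} r≤s)

  ≤-fromDifference : ∀ {p q r} → 0ℚ ≤ r → p + r ≡ q → p ≤ q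
  ≤-fromDifference {p} {q} {r} 0≤r p+r≡q = begin
    p       ≡⟨ sym (+-identityʳ p) ⟩
    p + 0ℚ  ≤⟨ +-monoʳ-≤ p 0≤r ⟩
    p + r   ≡⟨ p+r≡q ⟩
    q       ∎
    where open ≤-Reasoning

  *-cancelʳ-≡ : ∀ {p q} r .{{_ : NonZero r}} → p * r ≡ q * r → p ≡ q
  *-cancelʳ-≡ {p} {q} r pr≡qr = begin
    p                ≡⟨ sym (p*r*1/r≡p p) ⟩
    p * r * (1/ r)   ≡⟨ cong (_* (1/ r)) pr≡qr ⟩
    q * r * (1/ r)   ≡⟨ p*r*1/r≡p q ⟩
    q                ∎
    where
    open ≡-Reasoning
    p*r*1/r≡p : ∀ p → p * r * (1/ r) ≡ p
    p*r*1/r≡p p = trans (*-assoc p r (1/ r)) (trans (cong (p *_) (*-inverseʳ r)) (*-identityʳ p))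

  ÷-* : ∀ p q .{{_ : NonZero q}} → (p ÷ q) * q ≡ p
  ÷-* p q = trans (*-assoc p (1/ q) q) (trans (cong (p *_) (*-inverseˡ q)) (*-identityʳ p))

  nonZero-* : ∀ p q .{{_ : NonZero p}} .{{_ : NonZero q}} → NonZero (p * q)
  nonZero-* p q = ≢-nonZero λ pq≡0 → nz (*-cancelʳ-≡ q (trans pq≡0 (sym (*-zeroˡ q))))
    where
    nz : p ≢ 0ℚ
    nz refl = contradiction (*-inverseˡ p) λ 0≡1 → 1≢0 (trans (sym 0≡1) (*-zeroʳ (1/ p)))

  ∣p-q∣≡∣q-p∣ : ∀ p q → ∣ p - q ∣ ≡ ∣ q - p ∣
  ∣p-q∣≡∣q-p∣ p q = trans (sym (∣-p∣≡∣p∣ (p - q)))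
    (cong ∣_∣ (solve 2 (λ a b → :- (a :- b) := b :- a) refl p q))

  archimedean : ∀ p → ∃[ n ] p < fromℕ n
  archimedean p@(mkℚ (ℤ.+ n) d _) = suc n , *<* (subst₂ ℤ._<_ (sym (ℤ.*-identityʳ (ℤ.+ n)))
    (ℤ.pos-* (suc n) (suc d)) (ℤ.+<+ (ℕ.<-≤-trans (ℕ.n<1+n n) (ℕ.m≤m*n (suc n) (suc d)))))
  archimedean p@(mkℚ ℤ.-[1+ n ] d _) = 0 , *<* ℤ.-<+

  archimedeanδ : ∀ p {ε} → 0ℚ < ε → ∃[ n ] p < fromℕ n * ε
  archimedeanδ p {ε} 0<ε = n , (begin-strict
    p                     ≡⟨ sym (÷-* p ε) ⟩
    (p ÷ ε) * ε           <⟨ *-monoˡ-<-pos ε {{positive 0<ε}} p/ε<n ⟩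
    fromℕ n * ε           ∎)
    where
    open ≤-Reasoning
    instance ε≢0 = >-nonZero 0<ε
    n = proj₁ (archimedean (p ÷ ε))
    p/ε<n = proj₂ (archimedean (p ÷ ε))

open ℚ-Lemmas

-- Reals are Cauchy sequences of rationals, with _≃ᴿ_ as equality; the
-- standard library has no real numbers.
IsCauchy : (ℕ → ℚ) → Set
IsCauchy x = ∀ ε → 0ℚ < ε → ∃[ N ] (∀ m n → N ℕ.≤ m → N ℕ.≤ n → ∣ x m - x n ∣ < ε)

record ℝ : Set where
  constructor mkℝ
  field
    seq    : ℕ → ℚ
    cauchy : IsCauchy seq

open ℝ public

infix 4 _≃ᴿ_
_≃ᴿ_ : ℝ → ℝ → Set
x ≃ᴿ y = ∀ ε → 0ℚ < ε → ∃[ N ] (∀ n → N ℕ.≤ n → ∣ seq x n - seq y n ∣ < ε)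

fromℚ : ℚ → ℝ
fromℚ q = mkℝ (λ _ → q) λ ε 0<ε → 0 , λ _ _ _ _ →
  subst (_< ε) (sym (cong ∣_∣ (+-inverseʳ q))) 0<ε

½ε+½ε : ∀ ε → ½ * ε + ½ * ε ≡ ε
½ε+½ε = solve 1 (λ ε → con ½ :* ε :+ con ½ :* ε := ε) refl

0<½ε : ∀ {ε} → 0ℚ < ε → 0ℚ < ½ * ε
0<½ε = 0<p*q (positive⁻¹ ½)

⊔-left : ∀ {M N n} → M ℕ.⊔ N ℕ.≤ n → M ℕ.≤ n
⊔-left {M} {N} = ℕ.≤-trans (ℕ.m≤m⊔n M N)

⊔-right : ∀ {M N n} → M ℕ.⊔ N ℕ.≤ n → N ℕ.≤ n
⊔-right {M} {N} = ℕ.≤-trans (ℕ.m≤n⊔m M N)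

infixl 6 _+ᴿ_
_+ᴿ_ : ℝ → ℝ → ℝ
x +ᴿ y = mkℝ (λ n → seq x n + seq y n) λ ε 0<ε →
  let M , x-close = cauchy x (½ * ε) (0<½ε 0<ε)
      N , y-close = cauchy y (½ * ε) (0<½ε 0<ε)
  in M ℕ.⊔ N , λ m n m≥ n≥ → begin-strict
    ∣ (seq x m + seq y m) - (seq x n + seq y n) ∣
      ≡⟨ cong ∣_∣ (solve 4 (λ a b c d → (a :+ b) :- (c :+ d) := (a :- c) :+ (b :- d)) refl
           (seq x m) (seq y m) (seq x n) (seq y n)) ⟩
    ∣ (seq x m - seq x n) + (seq y m - seq y n) ∣
      ≤⟨ ∣p+q∣≤∣p∣+∣q∣ (seq x m - seq x n) (seq y m - seq y n) ⟩
    ∣ seq x m - seq x n ∣ + ∣ seq y m - seq y n ∣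
      <⟨ +-mono-< (x-close m n (⊔-left m≥) (⊔-left n≥)) (y-close m n (⊔-right {M} m≥) (⊔-right {M} n≥)) ⟩
    ½ * ε + ½ * ε
      ≡⟨ ½ε+½ε ε ⟩
    ε ∎
  where open ≤-Reasoning

eventuallyBounded : ∀ x → ∃[ b ] ∃[ N ] (∀ n → N ℕ.≤ n → ∣ seq x n ∣ ≤ fromℕ b)
eventuallyBounded x = b , N , λ n n≥N → begin
  ∣ seq x n ∣
    ≡⟨ cong ∣_∣ (solve 2 (λ a c → a := (a :- c) :+ c) refl (seq x n) (seq x N)) ⟩
  ∣ (seq x n - seq x N) + seq x N ∣
    ≤⟨ ∣p+q∣≤∣p∣+∣q∣ (seq x n - seq x N) (seq x N) ⟩
  ∣ seq x n - seq x N ∣ + ∣ seq x N ∣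
    ≤⟨ +-monoˡ-≤ ∣ seq x N ∣ (<⇒≤ (close n N n≥N ℕ.≤-refl)) ⟩
  1ℚ + ∣ seq x N ∣
    ≤⟨ <⇒≤ (proj₂ (archimedean (1ℚ + ∣ seq x N ∣))) ⟩
  fromℕ b ∎
  where
  open ≤-Reasoning
  N = proj₁ (cauchy x 1ℚ (positive⁻¹ 1ℚ))
  close = proj₂ (cauchy x 1ℚ (positive⁻¹ 1ℚ))
  b = proj₁ (archimedean (1ℚ + ∣ seq x N ∣))

small : ∀ b {ε} → 0ℚ < ε → ∃[ δ ] (0ℚ < δ × fromℕ b * δ ≤ ε)
small b {ε} 0<ε = ε ÷ c , 0<p*q 0<ε (positive⁻¹ (1/ c) {{1/pos⇒pos c}}) , (begin
  fromℕ b * (ε ÷ c)   ≤⟨ *-monoʳ-≤-nonNeg (ε ÷ c) {{nonNegative 0≤δ}} (fromℕ-mono (ℕ.n≤1+n b)) ⟩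
  c * (ε ÷ c)         ≡⟨ *-comm c (ε ÷ c) ⟩
  (ε ÷ c) * c         ≡⟨ ÷-* ε c ⟩
  ε                   ∎)
  where
  open ≤-Reasoning
  c = fromℕ (suc b)
  0≤δ = 0≤p*q (<⇒≤ 0<ε) (<⇒≤ (positive⁻¹ (1/ c) {{1/pos⇒pos c}}))

infixl 7 _*ᴿ_
_*ᴿ_ : ℝ → ℝ → ℝ
x *ᴿ y = mkℝ (λ n → seq x n * seq y n) λ ε 0<ε →
  let b , K , x-bound = eventuallyBounded x
      c , L , y-bound = eventuallyBounded y
      δ , 0<δ , bδ≤ = small b (0<½ε 0<ε)
      η , 0<η , cη≤ = small (suc c) (0<½ε 0<ε)
      M , x-close = cauchy x η 0<η
      N , y-close = cauchy y δ 0<δ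
  in (K ℕ.⊔ L) ℕ.⊔ (M ℕ.⊔ N) , λ m n m≥ n≥ → begin-strict
    ∣ seq x m * seq y m - seq x n * seq y n ∣
      ≡⟨ cong ∣_∣ (solve 4 (λ p q r s → p :* q :- r :* s := p :* (q :- s) :+ s :* (p :- r)) refl
           (seq x m) (seq y m) (seq x n) (seq y n)) ⟩
    ∣ seq x m * (seq y m - seq y n) + seq y n * (seq x m - seq x n) ∣
      ≤⟨ ∣p+q∣≤∣p∣+∣q∣ (seq x m * (seq y m - seq y n)) (seq y n * (seq x m - seq x n)) ⟩
    ∣ seq x m * (seq y m - seq y n) ∣ + ∣ seq y n * (seq x m - seq x n) ∣
      ≡⟨ cong₂ _+_ (∣p*q∣≡∣p∣*∣q∣ (seq x m) _) (∣p*q∣≡∣p∣*∣q∣ (seq y n) _) ⟩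
    ∣ seq x m ∣ * ∣ seq y m - seq y n ∣ + ∣ seq y n ∣ * ∣ seq x m - seq x n ∣
      ≤⟨ +-mono-≤
           (*-mono-≤ (0≤fromℕ b) (0≤∣p∣ _) (x-bound m (⊔-left (⊔-left m≥)))
             (<⇒≤ (y-close m n (⊔-right {M} (⊔-right {K ℕ.⊔ L} m≥)) (⊔-right {M} (⊔-right {K ℕ.⊔ L} n≥)))))
           (*-monoʳ-≤-nonNeg ∣ seq x m - seq x n ∣ {{∣-∣-nonNeg (seq x m - seq x n)}}
             (≤-trans (y-bound n (⊔-right {K} (⊔-left n≥))) (fromℕ-mono (ℕ.n≤1+n c)))) ⟩
    fromℕ b * δ + fromℕ (suc c) * ∣ seq x m - seq x n ∣
      <⟨ +-monoʳ-< (fromℕ b * δ) (*-monoʳ-<-pos (fromℕ (suc c))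
           (x-close m n (⊔-left (⊔-right {K ℕ.⊔ L} m≥)) (⊔-left (⊔-right {K ℕ.⊔ L} n≥)))) ⟩
    fromℕ b * δ + fromℕ (suc c) * η
      ≤⟨ +-mono-≤ bδ≤ cη≤ ⟩
    ½ * ε + ½ * ε
      ≡⟨ ½ε+½ε ε ⟩
    ε ∎
  where open ≤-Reasoning

-- Apartness from 0, as needed for a constructive reciprocal.
NonZeroᴿ : ℝ → Set
NonZeroᴿ x = ∃[ δ ] (0ℚ < δ × ∃[ N ] (∀ n → N ℕ.≤ n → δ ≤ ∣ seq x n ∣))

-- Finitely many entries of a sequence representing a nonzero real may
-- vanish; those are sent to 0.
1/₀_ : ℚ → ℚ
1/₀ q with q ≟ 0ℚ
... | yes _   = 0ℚ
... | no  q≢0 = (1/ q) {{≢-nonZero q≢0}}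

1/₀-inverse : ∀ q → 0ℚ < ∣ q ∣ → 1/₀ q * q ≡ 1ℚ
1/₀-inverse q 0<∣q∣ with q ≟ 0ℚ
... | yes refl = contradiction refl (<⇒≢ 0<∣q∣)
... | no  q≢0  = *-inverseˡ q {{≢-nonZero q≢0}}

infix 8 1/ᴿ
1/ᴿ : (x : ℝ) → NonZeroᴿ x → ℝ
1/ᴿ x (δ , 0<δ , K , x-bound) = mkℝ (λ n → 1/₀ seq x n) λ ε 0<ε →
  let N , close = cauchy x (ε * (δ * δ)) (0<p*q 0<ε (0<p*q 0<δ 0<δ))
  in K ℕ.⊔ N , λ m n m≥ n≥ →
    let p = seq x m
        q = seq x n
        w = 1/₀ p - 1/₀ q
        δ≤p = x-bound m (⊔-left m≥)
        δ≤q = x-bound n (⊔-left n≥)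
    in *-cancelʳ-<-nonNeg (δ * δ) {{nonNegative (<⇒≤ (0<p*q 0<δ 0<δ))}} (begin-strict
      ∣ w ∣ * (δ * δ)
        ≤⟨ *-monoˡ-≤-nonNeg ∣ w ∣ {{∣-∣-nonNeg w}} (*-mono-≤ (0≤∣p∣ p) (<⇒≤ 0<δ) δ≤p δ≤q) ⟩
      ∣ w ∣ * (∣ p ∣ * ∣ q ∣)
        ≡⟨ cong (∣ w ∣ *_) (sym (∣p*q∣≡∣p∣*∣q∣ p q)) ⟩
      ∣ w ∣ * ∣ p * q ∣
        ≡⟨ sym (∣p*q∣≡∣p∣*∣q∣ w (p * q)) ⟩
      ∣ w * (p * q) ∣
        ≡⟨ cong ∣_∣ (solve 4 (λ a b c d → (a :- b) :* (c :* d) := (a :* c) :* d :- (b :* d) :* c) refl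
             (1/₀ p) (1/₀ q) p q) ⟩
      ∣ 1/₀ p * p * q - 1/₀ q * q * p ∣
        ≡⟨ cong₂ (λ a b → ∣ a * q - b * p ∣)
             (1/₀-inverse p (<-≤-trans 0<δ δ≤p)) (1/₀-inverse q (<-≤-trans 0<δ δ≤q)) ⟩
      ∣ 1ℚ * q - 1ℚ * p ∣
        ≡⟨ cong₂ (λ a b → ∣ a - b ∣) (*-identityˡ q) (*-identityˡ p) ⟩
      ∣ q - p ∣
        <⟨ close n m (⊔-right {K} n≥) (⊔-right {K} m≥) ⟩
      ε * (δ * δ) ∎)
  where open ≤-Reasoning

∑ᴿ : ℕ → (ℕ → ℝ) → ℝ
∑ᴿ zero    f = fromℚ 0ℚ
∑ᴿ (suc n) f = ∑ᴿ n f +ᴿ f (suc n)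

syntax ∑ᴿ n (λ k → t) = ∑ᴿ[ 1≤ k ≤ n ] t

partialSums : (ℕ → ℚ) → ℕ → ℚ
partialSums t n = ∑[ k < n ] t k

RatioTest : (ℕ → ℚ) → Set
RatioTest t = ∃[ M ] (∀ m → M ℕ.≤ m → fromℕ 2 * ∣ t (suc m) ∣ ≤ ∣ t m ∣)

ratioTest⇒cauchy : ∀ t → RatioTest t → IsCauchy (partialSums t)
ratioTest⇒cauchy t (M , ratio) ε 0<ε = N , λ m n m≥ n≥ → begin-strict
  ∣ s m - s n ∣
    ≡⟨ cong ∣_∣ (solve 3 (λ a b c → a :- b := (a :- c) :- (b :- c)) refl (s m) (s n) (s N)) ⟩
  ∣ (s m - s N) - (s n - s N) ∣
    ≤⟨ ∣p-q∣≤∣p∣+∣q∣ (s m - s N) (s n - s N) ⟩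
  ∣ s m - s N ∣ + ∣ s n - s N ∣
    ≤⟨ +-mono-≤ (tail≤ m≥) (tail≤ n≥) ⟩
  2ℚ * ∣ t N ∣ + 2ℚ * ∣ t N ∣
    ≡⟨ solve 1 (λ a → con 2ℚ :* a :+ con 2ℚ :* a := con 4ℚ :* a) refl ∣ t N ∣ ⟩
  4ℚ * ∣ t N ∣
    <⟨ tN-small ⟩
  ε ∎
  where
  open ≤-Reasoning
  s = partialSums t
  4ℚ = fromℕ 4

  -- |s(m+d) - s(m)| + 2|t(m+d)| ≤ 2|t(m)|
  tail : ∀ m → M ℕ.≤ m → ∀ d → ∣ s (d ℕ.+ m) - s m ∣ + 2ℚ * ∣ t (d ℕ.+ m) ∣ ≤ 2ℚ * ∣ t m ∣
  tail m m≥ zero = ≤-reflexive (trans (cong (λ a → ∣ a ∣ + 2ℚ * ∣ t m ∣) (+-inverseʳ (s m)))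
    (+-identityˡ _))
  tail m m≥ (suc d) = begin
    ∣ s k + t k - s m ∣ + 2ℚ * ∣ t (suc k) ∣
      ≡⟨ cong (λ a → ∣ a ∣ + 2ℚ * ∣ t (suc k) ∣)
           (solve 3 (λ a b c → a :+ b :- c := (a :- c) :+ b) refl (s k) (t k) (s m)) ⟩
    ∣ (s k - s m) + t k ∣ + 2ℚ * ∣ t (suc k) ∣
      ≤⟨ +-mono-≤ (∣p+q∣≤∣p∣+∣q∣ (s k - s m) (t k)) (ratio k (ℕ.≤-trans m≥ (ℕ.m≤n+m m d))) ⟩
    ∣ s k - s m ∣ + ∣ t k ∣ + ∣ t k ∣
      ≡⟨ solve 2 (λ a b → a :+ b :+ b := a :+ con 2ℚ :* b) refl ∣ s k - s m ∣ ∣ t k ∣ ⟩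
    ∣ s k - s m ∣ + 2ℚ * ∣ t k ∣
      ≤⟨ tail m m≥ d ⟩
    2ℚ * ∣ t m ∣ ∎
    where k = d ℕ.+ m

  decay : ∀ d → fromℕ (suc d) * ∣ t (d ℕ.+ M) ∣ ≤ ∣ t M ∣
  decay zero    = ≤-reflexive (*-identityˡ _)
  decay (suc d) = begin
    fromℕ (2 ℕ.+ d) * a′
      ≤⟨ *-monoʳ-≤-nonNeg a′ {{∣-∣-nonNeg (t (suc k))}} (fromℕ-mono 2+d≤) ⟩
    fromℕ (suc d ℕ.* 2) * a′
      ≡⟨ cong (_* a′) (fromℕ-* (suc d) 2) ⟩
    fromℕ (suc d) * 2ℚ * a′
      ≡⟨ *-assoc (fromℕ (suc d)) 2ℚ a′ ⟩
    fromℕ (suc d) * (2ℚ * a′)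
      ≤⟨ *-monoˡ-≤-nonNeg (fromℕ (suc d)) (ratio k (ℕ.m≤n+m M d)) ⟩
    fromℕ (suc d) * ∣ t k ∣
      ≤⟨ decay d ⟩
    ∣ t M ∣ ∎
    where
    k = d ℕ.+ M
    a′ = ∣ t (suc k) ∣
    2+d≤ : 2 ℕ.+ d ℕ.≤ suc d ℕ.* 2
    2+d≤ = s≤s (s≤s (ℕ.m≤m*n d 2))

  D = proj₁ (archimedeanδ (4ℚ * ∣ t M ∣) 0<ε)
  N = D ℕ.+ M

  tN-small : 4ℚ * ∣ t N ∣ < ε
  tN-small = *-cancelˡ-<-nonNeg (fromℕ (suc D)) (begin-strict
    fromℕ (suc D) * (4ℚ * ∣ t N ∣)
      ≡⟨ solve 2 (λ a b → a :* (con 4ℚ :* b) := con 4ℚ :* (a :* b)) refl (fromℕ (suc D)) ∣ t N ∣ ⟩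
    4ℚ * (fromℕ (suc D) * ∣ t N ∣)
      ≤⟨ *-monoˡ-≤-nonNeg 4ℚ (decay D) ⟩
    4ℚ * ∣ t M ∣
      <⟨ proj₂ (archimedeanδ (4ℚ * ∣ t M ∣) 0<ε) ⟩
    fromℕ D * ε
      ≤⟨ *-monoʳ-≤-nonNeg ε {{nonNegative (<⇒≤ 0<ε)}} (fromℕ-mono (ℕ.n≤1+n D)) ⟩
    fromℕ (suc D) * ε ∎)

  tail≤ : ∀ {m} → N ℕ.≤ m → ∣ s m - s N ∣ ≤ 2ℚ * ∣ t N ∣
  tail≤ {m} m≥ = subst (λ k → ∣ s k - s N ∣ ≤ 2ℚ * ∣ t N ∣) (ℕ.m∸n+n≡m m≥) (begin
    ∣ s k - s N ∣
      ≤⟨ ≤-fromDifference (0≤p*q (0≤fromℕ 2) (0≤∣p∣ (t k))) refl ⟩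
    ∣ s k - s N ∣ + 2ℚ * ∣ t k ∣
      ≤⟨ tail N (ℕ.m≤n+m M D) (m ∸ N) ⟩
    2ℚ * ∣ t N ∣ ∎)
    where k = (m ∸ N) ℕ.+ N

series : (t : ℕ → ℚ) → RatioTest t → ℝ
series t r = mkℝ (partialSums t) (ratioTest⇒cauchy t r)

1/!-step : ∀ m → 1/! suc m * fromℕ (suc m) ≡ 1/! m
1/!-step m = *-cancelʳ-≡ (fromℕ (m !)) {{m ℕ.!≢0}} (begin
  1/! suc m * fromℕ (suc m) * fromℕ (m !)   ≡⟨ *-assoc (1/! suc m) _ _ ⟩
  1/! suc m * (fromℕ (suc m) * fromℕ (m !)) ≡⟨ cong (1/! suc m *_) (sym (fromℕ-* (suc m) (m !))) ⟩
  1/! suc m * fromℕ (suc m !)               ≡⟨ *-inverseˡ (fromℕ (suc m !)) {{suc m ℕ.!≢0}} ⟩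
  1ℚ                                         ≡⟨ sym (*-inverseˡ (fromℕ (m !)) {{m ℕ.!≢0}}) ⟩
  1/! m * fromℕ (m !)                       ∎)
  where open ≡-Reasoning

0≤1/! : ∀ m → 0ℚ ≤ 1/! m
0≤1/! m = <⇒≤ (positive⁻¹ (1/! m) {{1/pos⇒pos (fromℕ (m !)) {{posn}}}})
  where
  posn : Positive (fromℕ (m !))
  posn = positive (<-≤-trans (positive⁻¹ 1ℚ) (fromℕ-mono (ℕ.1≤n! m)))

1/!-ratioTest : RatioTest (λ k → 1/! k)
1/!-ratioTest = 1 , λ m m≥1 → begin
  2ℚ * ∣ 1/! suc m ∣              ≡⟨ cong (2ℚ *_) (0≤p⇒∣p∣≡p (0≤1/! (suc m))) ⟩
  2ℚ * 1/! suc m                  ≤⟨ *-monoʳ-≤-nonNeg (1/! suc m) {{nonNegative (0≤1/! (suc m))}} (fromℕ-mono (s≤s m≥1)) ⟩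
  fromℕ (suc m) * 1/! suc m       ≡⟨ *-comm (fromℕ (suc m)) (1/! suc m) ⟩
  1/! suc m * fromℕ (suc m)       ≡⟨ 1/!-step m ⟩
  1/! m                           ≡⟨ sym (0≤p⇒∣p∣≡p (0≤1/! m)) ⟩
  ∣ 1/! m ∣                       ∎
  where open ≤-Reasoning

e : ℝ
e = series (λ k → 1/! k) 1/!-ratioTest

e-nonZero : NonZeroᴿ e
e-nonZero = 1ℚ , positive⁻¹ 1ℚ , 1 , 1≤∣seq∣
  where
  1≤seq : ∀ n → 1ℚ ≤ seq e (suc n)
  1≤seq zero    = ≤-refl
  1≤seq (suc n) = ≤-trans (1≤seq n) (≤-fromDifference (0≤1/! (suc n)) refl)

  1≤∣seq∣ : ∀ n → 1 ℕ.≤ n → 1ℚ ≤ ∣ seq e n ∣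
  1≤∣seq∣ (suc n) _ = ≤-trans (1≤seq n)
    (≤-reflexive (sym (0≤p⇒∣p∣≡p (≤-trans (0≤fromℕ 1) (1≤seq n)))))

-- The rising factorial a (a + 1) ⋯ (a + m - 1).
pochhammer : ℚ → ℕ → ℚ
pochhammer a zero    = 1ℚ
pochhammer a (suc m) = pochhammer a m * (a + fromℕ m)

-- b ∉ {0, -1, -2, …}, the condition for every (b)_m to be invertible.
record Admissible (b : ℚ) : Set where
  field +ℕ-nonZero : ∀ m → NonZero (b + fromℕ m)

pochhammer-nonZero : ∀ b .{{_ : Admissible b}} m → NonZero (pochhammer b m)
pochhammer-nonZero b zero    = _
pochhammer-nonZero b {{adm}} (suc m) = nonZero-* (pochhammer b m) (b + fromℕ m)
  {{pochhammer-nonZero b m}} {{Admissible.+ℕ-nonZero adm m}}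

₁F₁-term : (a b : ℚ) .{{_ : Admissible b}} → ℚ → ℕ → ℚ
₁F₁-term a b z m = (pochhammer a m ÷ pochhammer b m) {{pochhammer-nonZero b m}} * (z ^ m * 1/! m)

₁F₁-step : ∀ a b .{{_ : Admissible b}} z m →
  ₁F₁-term a b z (suc m) * ((b + fromℕ m) * fromℕ (suc m)) ≡ ₁F₁-term a b z m * ((a + fromℕ m) * z)
₁F₁-step a b z m = *-cancelʳ-≡ B′ (begin
  A′b * (z * z ^ m * 1/! suc m) * (bm * fromℕ (suc m)) * B′
    ≡⟨ solve 7 (λ A′b z zm f bm n B′ →
         A′b :* (z :* zm :* f) :* (bm :* n) :* B′ := A′b :* (B′ :* bm) :* (z :* zm) :* (f :* n)) refl
         A′b z (z ^ m) (1/! suc m) bm (fromℕ (suc m)) B′ ⟩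
  A′b * (B′ * bm) * (z * z ^ m) * (1/! suc m * fromℕ (suc m))
    ≡⟨ cong₂ (λ u v → u * (z * z ^ m) * v) (÷-* (A′ * am) (B′ * bm)) (1/!-step m) ⟩
  A′ * am * (z * z ^ m) * 1/! m
    ≡⟨ cong (λ u → u * am * (z * z ^ m) * 1/! m) (sym (÷-* A′ B′)) ⟩
  A′/B′ * B′ * am * (z * z ^ m) * 1/! m
    ≡⟨ solve 6 (λ q B′ am z zm f → q :* B′ :* am :* (z :* zm) :* f := q :* (zm :* f) :* (am :* z) :* B′) refl
         A′/B′ B′ am z (z ^ m) (1/! m) ⟩
  A′/B′ * (z ^ m * 1/! m) * (am * z) * B′ ∎)
  where
  open ≡-Reasoning
  A′ = pochhammer a m
  B′ = pochhammer b m
  am = a + fromℕ m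
  bm = b + fromℕ m
  instance
    B′≢0 : NonZero B′
    B′≢0 = pochhammer-nonZero b m
    B′bm≢0 : NonZero (B′ * bm)
    B′bm≢0 = pochhammer-nonZero b (suc m)
  A′b = (A′ * am) ÷ (B′ * bm)
  A′/B′ = A′ ÷ B′

upper : ∀ a m → ∣ a + fromℕ m ∣ ≤ ∣ a ∣ + fromℕ m
upper a m = ≤-trans (∣p+q∣≤∣p∣+∣q∣ a (fromℕ m))
  (≤-reflexive (cong (∣ a ∣ +_) (0≤p⇒∣p∣≡p (0≤fromℕ m))))

lower : ∀ b m → fromℕ m ≤ ∣ b + fromℕ m ∣ + ∣ b ∣
lower b m = begin
  fromℕ m                  ≡⟨ sym (0≤p⇒∣p∣≡p (0≤fromℕ m)) ⟩
  ∣ fromℕ m ∣              ≡⟨ cong ∣_∣ (solve 2 (λ b m → m := (b :+ m) :- b) refl b (fromℕ m)) ⟩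
  ∣ (b + fromℕ m) - b ∣    ≤⟨ ∣p-q∣≤∣p∣+∣q∣ (b + fromℕ m) b ⟩
  ∣ b + fromℕ m ∣ + ∣ b ∣  ∎
  where open ≤-Reasoning

₁F₁-ratioTest : ∀ a b .{{_ : Admissible b}} z → RatioTest (₁F₁-term a b z)
₁F₁-ratioTest a b z = 5 ℕ.* K , λ m m≥ → ratio m m≥
  where
  open ≤-Reasoning
  t = ₁F₁-term a b z
  k = proj₁ (archimedean (∣ a ∣ + ∣ b ∣ + ∣ z ∣))
  K = suc k
  κ = fromℕ K

  sum≤κ : ∣ a ∣ + ∣ b ∣ + ∣ z ∣ ≤ κ
  sum≤κ = ≤-trans (<⇒≤ (proj₂ (archimedean (∣ a ∣ + ∣ b ∣ + ∣ z ∣)))) (fromℕ-mono (ℕ.n≤1+n _))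

  ∣a∣≤κ : ∣ a ∣ ≤ κ
  ∣a∣≤κ = ≤-trans (≤-fromDifference (0≤p+q (0≤∣p∣ b) (0≤∣p∣ z)) (sym (+-assoc (∣ a ∣) (∣ b ∣) (∣ z ∣)))) sum≤κ

  ∣b∣≤κ : ∣ b ∣ ≤ κ
  ∣b∣≤κ = ≤-trans (≤-fromDifference (0≤p+q (0≤∣p∣ a) (0≤∣p∣ z))
    (solve 3 (λ a b z → b :+ (a :+ z) := a :+ b :+ z) refl (∣ a ∣) (∣ b ∣) (∣ z ∣))) sum≤κ

  ∣z∣≤κ : ∣ z ∣ ≤ κ
  ∣z∣≤κ = ≤-trans (≤-fromDifference (0≤p+q (0≤∣p∣ a) (0≤∣p∣ b)) (+-comm ∣ z ∣ _)) sum≤κ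

  module _ (m : ℕ) (m≥ : 5 ℕ.* K ℕ.≤ m) where
    d = fromℕ (m ∸ 5 ℕ.* K)
    5ℚ = fromℕ 5
    4ℚ = fromℕ 4

    m≡ : fromℕ m ≡ d + 5ℚ * κ
    m≡ = trans (cong fromℕ (sym (ℕ.m∸n+n≡m m≥)))
      (trans (fromℕ-+ (m ∸ 5 ℕ.* K) (5 ℕ.* K)) (cong (λ w → d + w) (fromℕ-* 5 K)))

    4κ+d≤ : 4ℚ * κ + d ≤ ∣ b + fromℕ m ∣
    4κ+d≤ = begin
      4ℚ * κ + d                        ≡⟨ solve 2 (λ k d → con 4ℚ :* k :+ d := d :+ con 5ℚ :* k :- k) refl κ d ⟩
      d + 5ℚ * κ - κ                    ≡⟨ cong (_- κ) (sym m≡) ⟩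
      fromℕ m - κ                       ≤⟨ +-monoˡ-≤ (- κ) (lower b m) ⟩
      ∣ b + fromℕ m ∣ + ∣ b ∣ - κ       ≤⟨ +-monoˡ-≤ (- κ) (+-monoʳ-≤ ∣ b + fromℕ m ∣ ∣b∣≤κ) ⟩
      ∣ b + fromℕ m ∣ + κ - κ           ≡⟨ solve 2 (λ w k → w :+ k :- k := w) refl ∣ b + fromℕ m ∣ κ ⟩
      ∣ b + fromℕ m ∣                   ∎

    am≤ : ∣ a + fromℕ m ∣ ≤ κ + (d + 5ℚ * κ)
    am≤ = ≤-trans (upper a m) (+-mono-≤ ∣a∣≤κ (≤-reflexive m≡))

    0≤κ : 0ℚ ≤ κ
    0≤κ = 0≤fromℕ K

    0≤d : 0ℚ ≤ d
    0≤d = 0≤fromℕ (m ∸ 5 ℕ.* K)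

    remainder : ℚ
    remainder = fromℕ 8 * (κ * κ) + fromℕ 7 * (κ * d) + 4ℚ * κ + d * d + d

    factors : 2ℚ * (∣ a + fromℕ m ∣ * ∣ z ∣) ≤ ∣ b + fromℕ m ∣ * fromℕ (suc m)
    factors = begin
      2ℚ * (∣ a + fromℕ m ∣ * ∣ z ∣)
        ≤⟨ *-monoˡ-≤-nonNeg 2ℚ (*-mono-≤ (0≤p+q 0≤κ (0≤p+q 0≤d (0≤p*q (0≤fromℕ 5) 0≤κ))) (0≤∣p∣ z) am≤ ∣z∣≤κ) ⟩
      2ℚ * ((κ + (d + 5ℚ * κ)) * κ)
        ≤⟨ ≤-fromDifference {r = remainder}
             (0≤p+q (0≤p+q (0≤p+q (0≤p+q (0≤p*q (0≤fromℕ 8) (0≤p*q 0≤κ 0≤κ))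
               (0≤p*q (0≤fromℕ 7) (0≤p*q 0≤κ 0≤d))) (0≤p*q (0≤fromℕ 4) 0≤κ)) (0≤p*q 0≤d 0≤d)) 0≤d)
             (solve 2 (λ k d → con 2ℚ :* ((k :+ (d :+ con 5ℚ :* k)) :* k)
                 :+ (con (fromℕ 8) :* (k :* k) :+ con (fromℕ 7) :* (k :* d) :+ con 4ℚ :* k :+ d :* d :+ d)
               := (con 4ℚ :* k :+ d) :* (con 1ℚ :+ (d :+ con 5ℚ :* k))) refl κ d) ⟩
      (4ℚ * κ + d) * (1ℚ + (d + 5ℚ * κ))
        ≡⟨ cong (λ w → (4ℚ * κ + d) * w) (trans (cong (1ℚ +_) (sym m≡)) (sym (fromℕ-suc m))) ⟩
      (4ℚ * κ + d) * fromℕ (suc m)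
        ≤⟨ *-monoʳ-≤-nonNeg (fromℕ (suc m)) 4κ+d≤ ⟩
      ∣ b + fromℕ m ∣ * fromℕ (suc m) ∎

    c = ∣ b + fromℕ m ∣ * fromℕ (suc m)

    0<c : 0ℚ < c
    0<c = 0<p*q (<-≤-trans (<-≤-trans (0<p*q (0<fromℕ-suc 3) (0<fromℕ-suc k))
      (≤-fromDifference {4ℚ * κ} 0≤d refl)) 4κ+d≤) (0<fromℕ-suc m)

    ratio : 2ℚ * ∣ t (suc m) ∣ ≤ ∣ t m ∣
    ratio = *-cancelʳ-≤-pos c {{positive 0<c}} (begin
      2ℚ * ∣ t (suc m) ∣ * c
        ≡⟨ *-assoc 2ℚ ∣ t (suc m) ∣ c ⟩
      2ℚ * (∣ t (suc m) ∣ * c)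
        ≡⟨ cong (λ w → 2ℚ * (∣ t (suc m) ∣ * (∣ b + fromℕ m ∣ * w))) (sym (0≤p⇒∣p∣≡p (0≤fromℕ (suc m)))) ⟩
      2ℚ * (∣ t (suc m) ∣ * (∣ b + fromℕ m ∣ * ∣ fromℕ (suc m) ∣))
        ≡⟨ cong (2ℚ *_) (sym (∣pqr∣ (t (suc m)) (b + fromℕ m) (fromℕ (suc m)))) ⟩
      2ℚ * ∣ t (suc m) * ((b + fromℕ m) * fromℕ (suc m)) ∣
        ≡⟨ cong (λ w → 2ℚ * ∣ w ∣) (₁F₁-step a b z m) ⟩
      2ℚ * ∣ t m * ((a + fromℕ m) * z) ∣
        ≡⟨ cong (2ℚ *_) (∣pqr∣ (t m) (a + fromℕ m) z) ⟩
      2ℚ * (∣ t m ∣ * (∣ a + fromℕ m ∣ * ∣ z ∣))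
        ≡⟨ solve 2 (λ u v → con 2ℚ :* (u :* v) := u :* (con 2ℚ :* v)) refl ∣ t m ∣ (∣ a + fromℕ m ∣ * ∣ z ∣) ⟩
      ∣ t m ∣ * (2ℚ * (∣ a + fromℕ m ∣ * ∣ z ∣))
        ≤⟨ *-monoˡ-≤-nonNeg ∣ t m ∣ {{∣-∣-nonNeg (t m)}} factors ⟩
      ∣ t m ∣ * c ∎)
      where
      ∣pqr∣ : ∀ p q r → ∣ p * (q * r) ∣ ≡ ∣ p ∣ * (∣ q ∣ * ∣ r ∣)
      ∣pqr∣ p q r = trans (∣p*q∣≡∣p∣*∣q∣ p (q * r)) (cong (∣ p ∣ *_) (∣p*q∣≡∣p∣*∣q∣ q r))

-- Kummer's confluent hypergeometric function ₁F₁(a; b; z) at rational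
-- parameters and argument; its value is real.
₁F₁ : (a b : ℚ) .{{_ : Admissible b}} → ℚ → ℝ
₁F₁ a b z = series (₁F₁-term a b z) (₁F₁-ratioTest a b z)

instance
  fromℕ-suc-admissible : ∀ {n} → Admissible (fromℕ (suc n))
  fromℕ-suc-admissible {n} = record
    { +ℕ-nonZero = λ m → subst NonZero (fromℕ-+ (suc n) m) _ }

{-# OPTIONS --safe #-}

-- Let E_N be the N-th partial sum of e.  Multiplying out,
-- k! ₁F₁(k + 1; 2; 1) = Σ_m (m + 1)_k / (m + 1)!, and
-- Σ_k (-1)^(n - k) S(n, k) (x)_k = x^n, so the N-th partial sum of the
-- right-hand side, before division by e, is Σ_{j ≤ N} j^n / j!.  Expanding j^n in
-- falling factorials turns this into Σ_k S(n, k) E_{N + 1 - k}, which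
-- approaches e Σ_k S(n, k).  Finally B_n = Σ_k S(n, k): the coefficients
-- n!/k! [x^n] (exp x - 1)^k satisfy the recurrence of S(n, k), because
-- f = exp x - 1 satisfies f′ = f + 1.
module Submission where

open import Data.Nat.Base as ℕ using (ℕ; zero; suc; NonZero; _∸_; _!; z≤n; s≤s)
open import Data.Nat.Combinatorics using (_C_; k>n⇒nCk≡0; nCk+nC[k+1]≡[n+1]C[k+1])
import Data.Nat.Properties as ℕ
open import Data.Product.Base using (_,_; ∃-syntax; proj₂)
open import Data.Rational.Base using (ℚ; 0ℚ; 1ℚ; -_; _+_; _-_; _*_; _÷_; ½; ∣_∣; _<_; _≤_)
open import Data.Rational.Properties
  using (+-*-rawSemiring; +-comm; +-assoc; +-identityˡ; +-identityʳ; *-comm; *-assoc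
    ; *-identityˡ; *-identityʳ; *-zeroˡ; *-zeroʳ; *-distribˡ-+; *-inverseˡ; +-mono-<; +-monoʳ-<
    ; *-monoˡ-≤-nonNeg; *-monoʳ-≤-nonNeg; <⇒≤; <-≤-trans; positive⁻¹; ∣p+q∣≤∣p∣+∣q∣
    ; ∣p*q∣≡∣p∣*∣q∣; ∣-∣-nonNeg; module ≤-Reasoning)
open import Data.Rational.Solver using (module +-*-Solver)
open import Algebra.Definitions.RawSemiring +-*-rawSemiring using (_^_)
open import Relation.Binary.PropositionalEquality
open import Defs
open ℚ-Lemmas
open +-*-Solver using (solve; _:+_; _:*_; _:-_; :-_; _:=_; con)

-- Finite sums

∑-cong< : ∀ n {f g} → (∀ k → k ℕ.< n → f k ≡ g k) → ∑< n f ≡ ∑< n g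
∑-cong< zero    f≡g = refl
∑-cong< (suc n) f≡g = cong₂ _+_ (∑-cong< n λ k k<n → f≡g k (ℕ.m<n⇒m<1+n k<n)) (f≡g n (ℕ.n<1+n n))

∑-cong : ∀ n {f g} → (∀ k → f k ≡ g k) → ∑< n f ≡ ∑< n g
∑-cong n f≡g = ∑-cong< n λ k _ → f≡g k

∑-+ : ∀ n f g → ∑[ k < n ] (f k + g k) ≡ ∑< n f + ∑< n g
∑-+ zero    f g = refl
∑-+ (suc n) f g = trans (cong (_+ (f n + g n)) (∑-+ n f g))
  (solve 4 (λ a b c d → a :+ b :+ (c :+ d) := a :+ c :+ (b :+ d)) refl (∑< n f) (∑< n g) (f n) (g n))

∑-*ˡ : ∀ n c f → ∑[ k < n ] (c * f k) ≡ c * ∑< n f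
∑-*ˡ zero    c f = sym (*-zeroʳ c)
∑-*ˡ (suc n) c f = trans (cong (_+ c * f n) (∑-*ˡ n c f)) (sym (*-distribˡ-+ c (∑< n f) (f n)))

∑-zero : ∀ n → ∑[ k < n ] 0ℚ ≡ 0ℚ
∑-zero zero    = refl
∑-zero (suc n) = trans (+-identityʳ _) (∑-zero n)

∑-suc : ∀ n f → ∑< (suc n) f ≡ f 0 + ∑[ k < n ] f (suc k)
∑-suc zero    f = +-comm 0ℚ (f 0)
∑-suc (suc n) f = trans (cong (_+ f (suc n)) (∑-suc n f)) (+-assoc (f 0) _ (f (suc n)))

∑-swap : ∀ m n (f : ℕ → ℕ → ℚ) → ∑[ i < m ] ∑[ j < n ] f i j ≡ ∑[ j < n ] ∑[ i < m ] f i j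
∑-swap zero    n f = sym (∑-zero n)
∑-swap (suc m) n f = trans (cong (_+ ∑< n (f m)) (∑-swap m n f)) (sym (∑-+ n _ (f m)))

fromℕ-∸ : ∀ {m n} → m ℕ.≤ n → fromℕ (n ∸ m) ≡ fromℕ n - fromℕ m
fromℕ-∸ {m} {n} m≤n = begin
  fromℕ (n ∸ m)                      ≡⟨ solve 2 (λ a b → a := a :+ b :- b) refl (fromℕ (n ∸ m)) (fromℕ m) ⟩
  fromℕ (n ∸ m) + fromℕ m - fromℕ m  ≡⟨ cong (_- fromℕ m) (sym (fromℕ-+ (n ∸ m) m)) ⟩
  fromℕ (n ∸ m ℕ.+ m) - fromℕ m      ≡⟨ cong (λ k → fromℕ k - fromℕ m) (ℕ.m∸n+n≡m m≤n) ⟩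
  fromℕ n - fromℕ m                  ∎
  where open ≡-Reasoning

1/!*! : ∀ m → 1/! m * fromℕ (m !) ≡ 1ℚ
1/!*! m = *-inverseˡ (fromℕ (m !)) {{m ℕ.!≢0}}

-- Stirling numbers

C-Pascal : ∀ n k → fromℕ (suc n C suc k) ≡ fromℕ (n C k) + fromℕ (n C suc k)
C-Pascal n k = trans (cong fromℕ (sym (nCk+nC[k+1]≡[n+1]C[k+1] n k))) (fromℕ-+ (n C k) (n C suc k))

-- The difference is taken in ℚ, so no bound on `k` is required: for `k` above `n` both sides
-- vanish. Pascal's rule on both sides gives the induction.
C-absorb : ∀ n k → (fromℕ (suc n) - fromℕ k) * fromℕ (suc n C k) ≡ fromℕ (suc n) * fromℕ (n C k)
C-absorb n       zero          = cong (_* 1ℚ) (+-identityʳ (fromℕ (suc n)))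
C-absorb zero    (suc zero)    = refl
C-absorb zero    (suc (suc k)) = begin
  (1ℚ - fromℕ (2 ℕ.+ k)) * fromℕ (1 C (2 ℕ.+ k))  ≡⟨ cong (λ c → (1ℚ - fromℕ (2 ℕ.+ k)) * fromℕ c) (k>n⇒nCk≡0 {1} {2 ℕ.+ k} (s≤s (s≤s z≤n))) ⟩
  (1ℚ - fromℕ (2 ℕ.+ k)) * 0ℚ                     ≡⟨ *-zeroʳ (1ℚ - fromℕ (2 ℕ.+ k)) ⟩
  1ℚ * 0ℚ                                         ≡⟨ cong (λ c → 1ℚ * fromℕ c) (sym (k>n⇒nCk≡0 {0} {2 ℕ.+ k} (s≤s z≤n))) ⟩
  1ℚ * fromℕ (0 C (2 ℕ.+ k))                      ∎
  where open ≡-Reasoning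
C-absorb (suc n) (suc k) = begin
  (fromℕ (2 ℕ.+ n) - fromℕ (suc k)) * c″
    ≡⟨ cong₂ (λ a b → (a - b) * c″) (fromℕ-suc (suc n)) (fromℕ-suc k) ⟩
  (1ℚ + N - (1ℚ + K)) * c″
    ≡⟨ cong ((1ℚ + N - (1ℚ + K)) *_) (C-Pascal (suc n) k) ⟩
  (1ℚ + N - (1ℚ + K)) * (a + b)
    -- The common factor is N - K. Against `a` it fits the induction hypothesis for `k`; against `b`
    -- it is one more than the factor for `suc k`, which leaves the extra `b`.
    ≡⟨ solve 4 (λ N K a b → (con 1ℚ :+ N :- (con 1ℚ :+ K)) :* (a :+ b)
         := (N :- K) :* a :+ (N :- (con 1ℚ :+ K)) :* b :+ b) refl N K a b ⟩
  (N - K) * a + (N - (1ℚ + K)) * b + b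
    ≡⟨ cong₂ (λ u v → u + v + b) (C-absorb n k)
         (trans (cong (λ u → (N - u) * b) (sym (fromℕ-suc k))) (C-absorb n (suc k))) ⟩
  N * fromℕ (n C k) + N * fromℕ (n C suc k) + b
    ≡⟨ cong (_+ b) (sym (*-distribˡ-+ N (fromℕ (n C k)) (fromℕ (n C suc k)))) ⟩
  N * (fromℕ (n C k) + fromℕ (n C suc k)) + b
    ≡⟨ cong (λ u → N * u + b) (sym (C-Pascal n k)) ⟩
  N * b + b
    ≡⟨ solve 2 (λ N b → N :* b :+ b := (con 1ℚ :+ N) :* b) refl N b ⟩
  (1ℚ + N) * b
    ≡⟨ cong (_* b) (sym (fromℕ-suc (suc n))) ⟩
  fromℕ (2 ℕ.+ n) * b ∎
  where
  open ≡-Reasoning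
  N = fromℕ (suc n)
  K = fromℕ k
  a = fromℕ (suc n C k)
  b = fromℕ (suc n C suc k)
  c″ = fromℕ (suc (suc n) C suc k)

-- The sum is a finite difference of order k + 1, that is, the difference of order k of the first
-- differences of `g`. Pascal's rule splits each coefficient, and the alternating sign turns the
-- shifted half into the subtraction.
alternatingSum-suc : ∀ k (g : ℕ → ℚ) →
  ∑[ i < suc (suc k) ] ((- 1ℚ) ^ i * fromℕ (suc k C i) * g i) ≡
  ∑[ i < suc k ] ((- 1ℚ) ^ i * fromℕ (k C i) * (g i - g (suc i)))
alternatingSum-suc k g = begin
  ∑[ i < suc (suc k) ] (σ i * fromℕ (suc k C i) * g i)
    ≡⟨ ∑-suc (suc k) _ ⟩
  h 0 + ∑[ i < suc k ] (σ (suc i) * fromℕ (suc k C suc i) * g (suc i))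
    ≡⟨ cong (h 0 +_) (trans (∑-cong (suc k) split) (∑-+ (suc k) d (λ i → h (suc i)))) ⟩
  h 0 + (∑< (suc k) d + ∑[ i < suc k ] h (suc i))
    ≡⟨ solve 3 (λ a b c → a :+ (b :+ c) := a :+ c :+ b) refl (h 0) (∑< (suc k) d) _ ⟩
  h 0 + ∑[ i < suc k ] h (suc i) + ∑< (suc k) d
    ≡⟨ cong (_+ ∑< (suc k) d) (sym (∑-suc (suc k) h)) ⟩
  ∑< (suc k) h + h (suc k) + ∑< (suc k) d
    ≡⟨ cong (λ w → ∑< (suc k) h + w + ∑< (suc k) d) h-last ⟩
  ∑< (suc k) h + 0ℚ + ∑< (suc k) d
    ≡⟨ cong (_+ ∑< (suc k) d) (+-identityʳ (∑< (suc k) h)) ⟩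
  ∑< (suc k) h + ∑< (suc k) d
    ≡⟨ sym (∑-+ (suc k) h d) ⟩
  ∑[ i < suc k ] (h i + d i)
    ≡⟨ ∑-cong (suc k) (λ i → solve 4 (λ s c x y → s :* c :* x :+ (:- (s :* c :* y)) := s :* c :* (x :- y)) refl
         (σ i) (fromℕ (k C i)) (g i) (g (suc i))) ⟩
  ∑[ i < suc k ] (σ i * fromℕ (k C i) * (g i - g (suc i))) ∎
  where
  open ≡-Reasoning
  σ : ℕ → ℚ
  σ i = (- 1ℚ) ^ i
  h d : ℕ → ℚ
  h i = σ i * fromℕ (k C i) * g i
  d i = - (σ i * fromℕ (k C i) * g (suc i))

  split : ∀ i → σ (suc i) * fromℕ (suc k C suc i) * g (suc i) ≡ d i + h (suc i)
  split i = trans (cong (λ c → σ (suc i) * c * g (suc i)) (C-Pascal k i))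
    (solve 4 (λ s a b x → (con (- 1ℚ) :* s) :* (a :+ b) :* x
      := (:- (s :* a :* x)) :+ (con (- 1ℚ) :* s) :* b :* x) refl
      (σ i) (fromℕ (k C i)) (fromℕ (k C suc i)) (g (suc i)))

  h-last : h (suc k) ≡ 0ℚ
  h-last = trans (cong (λ c → σ (suc k) * fromℕ c * g (suc k)) (k>n⇒nCk≡0 (ℕ.n<1+n k)))
    (solve 2 (λ s x → s :* con 0ℚ :* x := con 0ℚ) refl (σ (suc k)) (g (suc k)))

-- k! S(n, k), the number of surjections from an n-set onto a k-set.
surjections : ℕ → ℕ → ℚ
surjections n k = ∑[ i < suc k ] ((- 1ℚ) ^ i * fromℕ (k C i) * fromℕ ((k ∸ i) ℕ.^ n))

-- The additional factor k + 1 - i of the power is absorbed into the binomial coefficient, which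
-- becomes (k + 1) C(k, i). Writing g(i) as (g(i) - g(i + 1)) + g(i + 1) then gives two sums:
-- `alternatingSum-suc` recognises the first as `surjections n (suc k)`, and the second is
-- `surjections n k` by definition.
surjections-suc : ∀ n k →
  surjections (suc n) (suc k) ≡ fromℕ (suc k) * (surjections n (suc k) + surjections n k)
surjections-suc n k = begin
  surjections (suc n) (suc k)
    ≡⟨ cong₂ _+_ (∑-cong< (suc k) absorb) last ⟩
  ∑[ i < suc k ] (K * p i) + 0ℚ
    ≡⟨ +-identityʳ _ ⟩
  ∑[ i < suc k ] (K * p i)
    ≡⟨ ∑-*ˡ (suc k) K p ⟩
  K * ∑< (suc k) p
    ≡⟨ cong (K *_) (∑-cong (suc k) λ i →
         solve 4 (λ s c x y → s :* c :* x := s :* c :* (x :- y) :+ s :* c :* y) refl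
           ((- 1ℚ) ^ i) (fromℕ (k C i)) (g i) (g (suc i))) ⟩
  K * ∑[ i < suc k ] (q i + r i)
    ≡⟨ cong (K *_) (∑-+ (suc k) q r) ⟩
  K * (∑< (suc k) q + surjections n k)
    ≡⟨ cong (λ w → K * (w + surjections n k)) (sym (alternatingSum-suc k g)) ⟩
  K * (surjections n (suc k) + surjections n k) ∎
  where
  open ≡-Reasoning
  K = fromℕ (suc k)
  g p q r : ℕ → ℚ
  g i = fromℕ ((suc k ∸ i) ℕ.^ n)
  p i = (- 1ℚ) ^ i * fromℕ (k C i) * g i
  q i = (- 1ℚ) ^ i * fromℕ (k C i) * (g i - g (suc i))
  r i = (- 1ℚ) ^ i * fromℕ (k C i) * g (suc i)

  absorb : ∀ i → i ℕ.< suc k →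
    (- 1ℚ) ^ i * fromℕ (suc k C i) * fromℕ ((suc k ∸ i) ℕ.^ suc n) ≡ K * p i
  absorb i i<1+k = begin
    s * c * fromℕ ((suc k ∸ i) ℕ.^ suc n)
      ≡⟨ cong (s * c *_) (fromℕ-* (suc k ∸ i) _) ⟩
    s * c * (fromℕ (suc k ∸ i) * g i)
      ≡⟨ cong (λ w → s * c * (w * g i)) (fromℕ-∸ (ℕ.<⇒≤ i<1+k)) ⟩
    s * c * ((K - fromℕ i) * g i)
      ≡⟨ solve 4 (λ s c w x → s :* c :* (w :* x) := s :* (w :* c) :* x) refl s c (K - fromℕ i) (g i) ⟩
    s * ((K - fromℕ i) * c) * g i
      ≡⟨ cong (λ w → s * w * g i) (C-absorb k i) ⟩
    s * (K * fromℕ (k C i)) * g i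
      ≡⟨ solve 4 (λ s K c x → s :* (K :* c) :* x := K :* (s :* c :* x)) refl s K (fromℕ (k C i)) (g i) ⟩
    K * p i ∎
    where
    s = (- 1ℚ) ^ i
    c = fromℕ (suc k C i)

  -- At i = k + 1 the base is 0, and the exponent `suc n` is positive.
  last : (- 1ℚ) ^ suc k * fromℕ (suc k C suc k) * fromℕ ((k ∸ k) ℕ.^ suc n) ≡ 0ℚ
  last = trans (cong (λ w → (- 1ℚ) ^ suc k * fromℕ (suc k C suc k) * fromℕ (w ℕ.^ suc n)) (ℕ.n∸n≡0 k))
    (*-zeroʳ ((- 1ℚ) ^ suc k * fromℕ (suc k C suc k)))

-- The triangular recurrence: together with the boundary values, it is all that the later arguments
-- use of the explicit formula.
S-suc-suc : ∀ n k → S (suc n) (suc k) ≡ fromℕ (suc k) * S n (suc k) + S n k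
S-suc-suc n k = begin
  f * surjections (suc n) (suc k)         ≡⟨ cong (f *_) (surjections-suc n k) ⟩
  f * (K * (a + b))                       ≡⟨ solve 4 (λ f K a b → f :* (K :* (a :+ b)) := K :* (f :* a) :+ f :* K :* b) refl f K a b ⟩
  K * (f * a) + f * K * b                 ≡⟨ cong (λ w → K * (f * a) + w * b) (1/!-step k) ⟩
  K * S n (suc k) + S n k                 ∎
  where
  open ≡-Reasoning
  f = 1/! suc k
  K = fromℕ (suc k)
  a = surjections n (suc k)
  b = surjections n k

-- With exponent 0 every power is 1, including 0 ^ 0 at the last index, so the first differences of
-- the summand are 0.
S-zero-suc : ∀ k → S 0 (suc k) ≡ 0ℚ
S-zero-suc k = begin
  1/! suc k * surjections 0 (suc k)
    ≡⟨ cong (1/! suc k *_) (alternatingSum-suc k (λ _ → 1ℚ)) ⟩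
  1/! suc k * ∑[ i < suc k ] ((- 1ℚ) ^ i * fromℕ (k C i) * 0ℚ)
    ≡⟨ cong (1/! suc k *_) (trans (∑-cong (suc k) λ i → *-zeroʳ ((- 1ℚ) ^ i * fromℕ (k C i))) (∑-zero (suc k))) ⟩
  1/! suc k * 0ℚ
    ≡⟨ *-zeroʳ (1/! suc k) ⟩
  0ℚ ∎
  where open ≡-Reasoning

-- The only summand has the factor `0 ℕ.^ suc n`, so this holds by computation. It is what lets the
-- sum over k begin at 1.
S-suc-zero : ∀ n → S (suc n) 0 ≡ 0ℚ
S-suc-zero n = refl

S-vanish : ∀ {n k} → n ℕ.< k → S n k ≡ 0ℚ
S-vanish {zero}  {suc k} _           = S-zero-suc k
S-vanish {suc n} {suc k} (s≤s n<k) = begin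
  S (suc n) (suc k)                      ≡⟨ S-suc-suc n k ⟩
  fromℕ (suc k) * S n (suc k) + S n k    ≡⟨ cong₂ (λ u v → fromℕ (suc k) * u + v) (S-vanish (ℕ.m<n⇒m<1+n n<k)) (S-vanish n<k) ⟩
  fromℕ (suc k) * 0ℚ + 0ℚ                ≡⟨ cong (_+ 0ℚ) (*-zeroʳ (fromℕ (suc k))) ⟩
  0ℚ                                     ∎
  where open ≡-Reasoning

-- Falling factorials

fallingFactorial : ℚ → ℕ → ℚ
fallingFactorial x zero    = 1ℚ
fallingFactorial x (suc k) = fallingFactorial x k * (x - fromℕ k)

-- Splits off the first factor, where the definition splits off the last; the first factor is the
-- one that cancels against a factorial.
fallingFactorial-suc : ∀ x k → fallingFactorial (1ℚ + x) (suc k) ≡ (1ℚ + x) * fallingFactorial x k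
fallingFactorial-suc x zero    = solve 1 (λ x → con 1ℚ :* (con 1ℚ :+ x :- con 0ℚ) := (con 1ℚ :+ x) :* con 1ℚ) refl x
fallingFactorial-suc x (suc k) = begin
  fallingFactorial (1ℚ + x) (suc k) * (1ℚ + x - fromℕ (suc k))
    ≡⟨ cong₂ (λ u v → u * (1ℚ + x - v)) (fallingFactorial-suc x k) (fromℕ-suc k) ⟩
  (1ℚ + x) * F * (1ℚ + x - (1ℚ + fromℕ k))
    ≡⟨ solve 3 (λ x F k → (con 1ℚ :+ x) :* F :* (con 1ℚ :+ x :- (con 1ℚ :+ k))
         := (con 1ℚ :+ x) :* (F :* (x :- k))) refl x F (fromℕ k) ⟩
  (1ℚ + x) * (F * (x - fromℕ k)) ∎
  where
  open ≡-Reasoning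
  F = fallingFactorial x k

fallingFactorial-0 : ∀ k → fallingFactorial 0ℚ (suc k) ≡ 0ℚ
fallingFactorial-0 zero    = refl
fallingFactorial-0 (suc k) = trans (cong (_* (0ℚ - fromℕ (suc k))) (fallingFactorial-0 k)) (*-zeroˡ (0ℚ - fromℕ (suc k)))

fallingFactorial-neg : ∀ x k → fallingFactorial (- x) k ≡ (- 1ℚ) ^ k * pochhammer x k
fallingFactorial-neg x zero    = refl
fallingFactorial-neg x (suc k) = trans (cong (_* (- x - fromℕ k)) (fallingFactorial-neg x k))
  (solve 4 (λ s p x k → s :* p :* (:- x :- k) := con (- 1ℚ) :* s :* (p :* (x :+ k))) refl
    ((- 1ℚ) ^ k) (pochhammer x k) x (fromℕ k))

-- Multiplying by x = k + (x - k) sends the k-th falling factorial to k times itself plus the next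
-- one. Collecting equal falling factorials reproduces the recurrence `S-suc-suc`.
^-fallingFactorial : ∀ x n → x ^ n ≡ ∑[ k < suc n ] (S n k * fallingFactorial x k)
^-fallingFactorial x zero    = refl
^-fallingFactorial x (suc n) = begin
  x * x ^ n
    ≡⟨ cong (x *_) (^-fallingFactorial x n) ⟩
  x * ∑[ k < suc n ] (S n k * F k)
    ≡⟨ sym (∑-*ˡ (suc n) x _) ⟩
  ∑[ k < suc n ] (x * (S n k * F k))
    ≡⟨ ∑-cong (suc n) (λ k → solve 4 (λ x s f k → x :* (s :* f) := k :* s :* f :+ s :* (f :* (x :- k))) refl
         x (S n k) (F k) (fromℕ k)) ⟩
  ∑[ k < suc n ] (h k + S n k * F (suc k))
    ≡⟨ ∑-+ (suc n) h _ ⟩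
  ∑< (suc n) h + ∑[ k < suc n ] (S n k * F (suc k))
    ≡⟨ cong (_+ ∑[ k < suc n ] (S n k * F (suc k))) shift ⟩
  ∑[ k < suc n ] h (suc k) + ∑[ k < suc n ] (S n k * F (suc k))
    ≡⟨ sym (∑-+ (suc n) _ _) ⟩
  ∑[ k < suc n ] (h (suc k) + S n k * F (suc k))
    ≡⟨ ∑-cong (suc n) (λ k → trans
         (solve 4 (λ k s f t → k :* s :* f :+ t :* f := (k :* s :+ t) :* f) refl (fromℕ (suc k)) (S n (suc k)) (F (suc k)) (S n k))
         (cong (_* F (suc k)) (sym (S-suc-suc n k)))) ⟩
  ∑[ k < suc n ] (S (suc n) (suc k) * F (suc k))
    -- This 0 is the term at k = 0, where `S (suc n) 0` computes to 0.
    ≡⟨ sym (+-identityˡ _) ⟩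
  0ℚ + ∑[ k < suc n ] (S (suc n) (suc k) * F (suc k))
    ≡⟨ sym (∑-suc (suc n) _) ⟩
  ∑[ k < suc (suc n) ] (S (suc n) k * F k) ∎
  where
  open ≡-Reasoning
  F h : ℕ → ℚ
  F = fallingFactorial x
  h k = fromℕ k * S n k * F k

  -- Reindexing costs nothing at either end: `h 0` has the factor 0, and `h (suc n)` has the factor
  -- `S n (suc n)`.
  shift : ∑< (suc n) h ≡ ∑[ k < suc n ] h (suc k)
  shift = begin
    ∑< (suc n) h
      ≡⟨ sym (+-identityʳ _) ⟩
    ∑< (suc n) h + 0ℚ
      ≡⟨ cong (∑< (suc n) h +_) (sym (trans (cong (λ s → fromℕ (suc n) * s * F (suc n)) (S-vanish (ℕ.n<1+n n)))
           (solve 2 (λ a f → a :* con 0ℚ :* f := con 0ℚ) refl (fromℕ (suc n)) (F (suc n))))) ⟩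
    ∑< (suc (suc n)) h
      ≡⟨ ∑-suc (suc n) h ⟩
    0ℚ * S n 0 * 1ℚ + ∑[ k < suc n ] h (suc k)
      ≡⟨ solve 2 (λ s w → con 0ℚ :* s :* con 1ℚ :+ w := w) refl (S n 0) _ ⟩
    ∑[ k < suc n ] h (suc k) ∎

-- Coefficients of the powers of exp x - 1

-- The formal derivative.
D : PowerSeries → PowerSeries
D f n = fromℕ (suc n) * f (suc n)

-- Leibniz's rule: the weight n + 1 is split as i + (n + 1 - i), one part for each factor. The first
-- sum loses its term at i = 0 and the second its term at i = n + 1.
D-*ₚ : ∀ f g n → D (f *ₚ g) n ≡ (D f *ₚ g) n + (f *ₚ D g) n
D-*ₚ f g n = begin
  N * ∑[ i < suc (suc n) ] (f i * g (suc n ∸ i))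
    ≡⟨ sym (∑-*ˡ (suc (suc n)) N _) ⟩
  ∑[ i < suc (suc n) ] (N * (f i * g (suc n ∸ i)))
    ≡⟨ ∑-cong (suc (suc n)) (λ i → solve 4 (λ N i x y → N :* (x :* y) := i :* x :* y :+ x :* ((N :- i) :* y)) refl
         N (fromℕ i) (f i) (g (suc n ∸ i))) ⟩
  ∑[ i < suc (suc n) ] (p i + q i)
    ≡⟨ ∑-+ (suc (suc n)) p q ⟩
  ∑< (suc (suc n)) p + ∑< (suc (suc n)) q
    ≡⟨ cong₂ _+_ left right ⟩
  (D f *ₚ g) n + (f *ₚ D g) n ∎
  where
  open ≡-Reasoning
  N = fromℕ (suc n)
  p q : ℕ → ℚ
  p i = fromℕ i * f i * g (suc n ∸ i)
  q i = f i * ((N - fromℕ i) * g (suc n ∸ i))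

  left : ∑< (suc (suc n)) p ≡ (D f *ₚ g) n
  left = trans (∑-suc (suc n) p)
    (solve 3 (λ x y z → con 0ℚ :* x :* y :+ z := z) refl (f 0) (g (suc n)) ((D f *ₚ g) n))

  right : ∑< (suc (suc n)) q ≡ (f *ₚ D g) n
  right = trans (cong₂ _+_ (∑-cong< (suc n) q-step)
      (solve 3 (λ x N y → x :* ((N :- N) :* y) := con 0ℚ) refl (f (suc n)) N (g (suc n ∸ suc n))))
    (+-identityʳ ((f *ₚ D g) n))
    where
    q-step : ∀ i → i ℕ.< suc n → q i ≡ f i * D g (n ∸ i)
    q-step i i<1+n = cong (f i *_) (begin
      (N - fromℕ i) * g (suc n ∸ i)          ≡⟨ cong (_* g (suc n ∸ i)) (sym (fromℕ-∸ (ℕ.<⇒≤ i<1+n))) ⟩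
      fromℕ (suc n ∸ i) * g (suc n ∸ i)      ≡⟨ cong (λ m → fromℕ m * g m) (ℕ.+-∸-assoc 1 (ℕ.≤-pred i<1+n)) ⟩
      D g (n ∸ i)                            ∎)

expₚ-1 : PowerSeries
expₚ-1 = expₚ -ₚ 1ₚ

D-expₚ-1 : ∀ n → D expₚ-1 n ≡ expₚ-1 n + 1ₚ n
D-expₚ-1 n = begin
  fromℕ (suc n) * (1/! suc n - 0ℚ)
    ≡⟨ solve 2 (λ N f → N :* (f :- con 0ℚ) := f :* N) refl (fromℕ (suc n)) (1/! suc n) ⟩
  1/! suc n * fromℕ (suc n)
    ≡⟨ 1/!-step n ⟩
  1/! n
    ≡⟨ solve 2 (λ f o → f := f :- o :+ o) refl (1/! n) (1ₚ n) ⟩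
  1/! n - 1ₚ n + 1ₚ n ∎
  where open ≡-Reasoning

*ₚ-identityˡ : ∀ f n → (1ₚ *ₚ f) n ≡ f n
*ₚ-identityˡ f n = begin
  ∑[ i < suc n ] (1ₚ i * f (n ∸ i))
    ≡⟨ ∑-suc n _ ⟩
  1ℚ * f n + ∑[ i < n ] (0ℚ * f (n ∸ suc i))
    ≡⟨ cong (1ℚ * f n +_) (trans (∑-cong n λ i → *-zeroˡ (f (n ∸ suc i))) (∑-zero n)) ⟩
  1ℚ * f n + 0ℚ
    ≡⟨ solve 1 (λ x → con 1ℚ :* x :+ con 0ℚ := x) refl (f n) ⟩
  f n ∎
  where open ≡-Reasoning

-- With f = exp x - 1, the derivative (j + 1) f^j f′ becomes (j + 1)(f^(j + 1) + f^j) because f′ = f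
-- + 1. Leibniz's rule peels off one factor `f`, and `second` appeals to this lemma at the preceding
-- exponent.
D-expₚ-1^ : ∀ j n → D (expₚ-1 ^ₚ suc j) n ≡ fromℕ (suc j) * ((expₚ-1 ^ₚ suc j) n + (expₚ-1 ^ₚ j) n)
D-expₚ-1^ j n = begin
  D (f *ₚ f ^ₚ j) n
    ≡⟨ D-*ₚ f (f ^ₚ j) n ⟩
  (D f *ₚ f ^ₚ j) n + (f *ₚ D (f ^ₚ j)) n
    ≡⟨ cong₂ _+_ first (second j) ⟩
  (f ^ₚ suc j) n + (f ^ₚ j) n + fromℕ j * ((f ^ₚ suc j) n + (f ^ₚ j) n)
    ≡⟨ solve 2 (λ s J → s :+ J :* s := (con 1ℚ :+ J) :* s) refl ((f ^ₚ suc j) n + (f ^ₚ j) n) (fromℕ j) ⟩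
  (1ℚ + fromℕ j) * ((f ^ₚ suc j) n + (f ^ₚ j) n)
    ≡⟨ cong (_* ((f ^ₚ suc j) n + (f ^ₚ j) n)) (sym (fromℕ-suc j)) ⟩
  fromℕ (suc j) * ((f ^ₚ suc j) n + (f ^ₚ j) n) ∎
  where
  open ≡-Reasoning
  f = expₚ-1

  first : (D f *ₚ f ^ₚ j) n ≡ (f ^ₚ suc j) n + (f ^ₚ j) n
  first = begin
    ∑[ i < suc n ] (D f i * (f ^ₚ j) (n ∸ i))
      ≡⟨ ∑-cong (suc n) (λ i → trans (cong (_* (f ^ₚ j) (n ∸ i)) (D-expₚ-1 i))
           (solve 3 (λ a b c → (a :+ b) :* c := a :* c :+ b :* c) refl (f i) (1ₚ i) ((f ^ₚ j) (n ∸ i)))) ⟩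
    ∑[ i < suc n ] (f i * (f ^ₚ j) (n ∸ i) + 1ₚ i * (f ^ₚ j) (n ∸ i))
      ≡⟨ ∑-+ (suc n) _ _ ⟩
    (f ^ₚ suc j) n + (1ₚ *ₚ f ^ₚ j) n
      ≡⟨ cong ((f ^ₚ suc j) n +_) (*ₚ-identityˡ (f ^ₚ j) n) ⟩
    (f ^ₚ suc j) n + (f ^ₚ j) n ∎

  second : ∀ j → (f *ₚ D (f ^ₚ j)) n ≡ fromℕ j * ((f ^ₚ suc j) n + (f ^ₚ j) n)
  second zero = begin
    ∑[ i < suc n ] (f i * (fromℕ (suc (n ∸ i)) * 0ℚ))
      ≡⟨ ∑-cong (suc n) (λ i → solve 2 (λ a b → a :* (b :* con 0ℚ) := con 0ℚ) refl (f i) (fromℕ (suc (n ∸ i)))) ⟩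
    ∑[ i < suc n ] 0ℚ
      ≡⟨ ∑-zero (suc n) ⟩
    0ℚ
      ≡⟨ sym (*-zeroˡ ((f ^ₚ 1) n + 1ₚ n)) ⟩
    0ℚ * ((f ^ₚ 1) n + 1ₚ n) ∎
  second (suc j) = begin
    ∑[ i < suc n ] (f i * D (f ^ₚ suc j) (n ∸ i))
      ≡⟨ ∑-cong (suc n) (λ i → trans (cong (f i *_) (D-expₚ-1^ j (n ∸ i)))
           (solve 4 (λ x J a b → x :* (J :* (a :+ b)) := J :* (x :* a :+ x :* b)) refl
             (f i) c ((f ^ₚ suc j) (n ∸ i)) ((f ^ₚ j) (n ∸ i)))) ⟩
    ∑[ i < suc n ] (c * (f i * (f ^ₚ suc j) (n ∸ i) + f i * (f ^ₚ j) (n ∸ i)))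
      ≡⟨ ∑-*ˡ (suc n) c _ ⟩
    c * ∑[ i < suc n ] (f i * (f ^ₚ suc j) (n ∸ i) + f i * (f ^ₚ j) (n ∸ i))
      ≡⟨ cong (c *_) (∑-+ (suc n) _ _) ⟩
    c * ((f ^ₚ suc (suc j)) n + (f ^ₚ suc j) n) ∎
    where c = fromℕ (suc j)

-- The factor n + 1 of (n + 1)! makes the coefficient one of a derivative, so `D-expₚ-1^` applies.
-- In the second resulting term its factor k + 1 lowers 1/(k + 1)! to 1/k!, and what remains is
-- `S-suc-suc`.
expₚ-1^-coefficient : ∀ n k → fromℕ (n !) * (1/! k * (expₚ-1 ^ₚ k) n) ≡ S n k
expₚ-1^-coefficient zero    zero    = refl
expₚ-1^-coefficient zero    (suc k) = trans
  -- The constant term of `expₚ-1` computes to 0, and it is a factor of the constant term of every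
  -- positive power.
  (solve 2 (λ u v → con 1ℚ :* (u :* (con 0ℚ :+ con 0ℚ :* v)) := con 0ℚ) refl (1/! suc k) ((expₚ-1 ^ₚ k) 0))
  (sym (S-zero-suc k))
expₚ-1^-coefficient (suc n) zero    = *-zeroʳ (fromℕ (suc n !))
expₚ-1^-coefficient (suc n) (suc k) = begin
  fromℕ (suc n !) * (u * P (suc k) (suc n))
    ≡⟨ cong (_* (u * P (suc k) (suc n))) (fromℕ-* (suc n) (n !)) ⟩
  fromℕ (suc n) * N! * (u * P (suc k) (suc n))
    ≡⟨ solve 4 (λ a b c d → a :* b :* (c :* d) := b :* c :* (a :* d)) refl (fromℕ (suc n)) N! u (P (suc k) (suc n)) ⟩
  N! * u * D (P (suc k)) n
    ≡⟨ cong (N! * u *_) (D-expₚ-1^ k n) ⟩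
  N! * u * (K * (P (suc k) n + P k n))
    ≡⟨ solve 5 (λ b u K x y → b :* u :* (K :* (x :+ y)) := K :* (b :* (u :* x)) :+ b :* (u :* K :* y)) refl
         N! u K (P (suc k) n) (P k n) ⟩
  K * (N! * (u * P (suc k) n)) + N! * (u * K * P k n)
    ≡⟨ cong (λ w → K * (N! * (u * P (suc k) n)) + N! * (w * P k n)) (1/!-step k) ⟩
  K * (N! * (u * P (suc k) n)) + N! * (1/! k * P k n)
    ≡⟨ cong₂ (λ x y → K * x + y) (expₚ-1^-coefficient n (suc k)) (expₚ-1^-coefficient n k) ⟩
  K * S n (suc k) + S n k
    ≡⟨ sym (S-suc-suc n k) ⟩
  S (suc n) (suc k) ∎
  where
  open ≡-Reasoning
  N! = fromℕ (n !)
  u = 1/! suc k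
  K = fromℕ (suc k)
  P : ℕ → PowerSeries
  P = expₚ-1 ^ₚ_

B-S : ∀ n → B n ≡ ∑[ k < suc n ] S n k
B-S n = trans (sym (∑-*ˡ (suc n) (fromℕ (n !)) _)) (∑-cong (suc n) (expₚ-1^-coefficient n))

-- Dobinski's formula

-- The summand is 1/(j - k)! for j ≥ k and 0 for j < k, so of the k + N terms the first k vanish and
-- the rest form a partial sum of `e`. The induction removes one vanishing term at a time.
fallingFactorial-series : ∀ k N →
  ∑[ j < k ℕ.+ N ] (fallingFactorial (fromℕ j) k * 1/! j) ≡ seq e N
fallingFactorial-series zero    N = ∑-cong N λ j → *-identityˡ (1/! j)
fallingFactorial-series (suc k) N = begin
  ∑[ j < suc (k ℕ.+ N) ] (fallingFactorial (fromℕ j) (suc k) * 1/! j)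
    ≡⟨ ∑-suc (k ℕ.+ N) _ ⟩
  fallingFactorial 0ℚ (suc k) * 1ℚ + ∑[ j < k ℕ.+ N ] (fallingFactorial (fromℕ (suc j)) (suc k) * 1/! suc j)
    ≡⟨ cong₂ _+_ (cong (_* 1ℚ) (fallingFactorial-0 k)) (∑-cong (k ℕ.+ N) step) ⟩
  0ℚ + ∑[ j < k ℕ.+ N ] (fallingFactorial (fromℕ j) k * 1/! j)
    ≡⟨ +-identityˡ _ ⟩
  ∑[ j < k ℕ.+ N ] (fallingFactorial (fromℕ j) k * 1/! j)
    ≡⟨ fallingFactorial-series k N ⟩
  seq e N ∎
  where
  open ≡-Reasoning
  step : ∀ j → fallingFactorial (fromℕ (suc j)) (suc k) * 1/! suc j ≡ fallingFactorial (fromℕ j) k * 1/! j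
  step j = begin
    fallingFactorial (fromℕ (suc j)) (suc k) * 1/! suc j
      ≡⟨ cong (λ x → fallingFactorial x (suc k) * 1/! suc j) (fromℕ-suc j) ⟩
    fallingFactorial (1ℚ + fromℕ j) (suc k) * 1/! suc j
      ≡⟨ cong (_* 1/! suc j) (fallingFactorial-suc (fromℕ j) k) ⟩
    (1ℚ + fromℕ j) * F * 1/! suc j
      ≡⟨ cong (λ x → x * F * 1/! suc j) (sym (fromℕ-suc j)) ⟩
    fromℕ (suc j) * F * 1/! suc j
      ≡⟨ solve 3 (λ J F f → J :* F :* f := F :* (f :* J)) refl (fromℕ (suc j)) F (1/! suc j) ⟩
    F * (1/! suc j * fromℕ (suc j))
      ≡⟨ cong (F *_) (1/!-step j) ⟩
    F * 1/! j ∎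
    where F = fallingFactorial (fromℕ j) k

-- An exact finite form of Dobinski's formula, by exchanging two finite sums. The bound on `n`
-- ensures that N = k + (N - k) for every k that occurs.
Dobinski-partialSum : ∀ n N → n ℕ.≤ N →
  ∑[ j < N ] (fromℕ j ^ n * 1/! j) ≡ ∑[ k < suc n ] (S n k * seq e (N ∸ k))
Dobinski-partialSum n N n≤N = begin
  ∑[ j < N ] (fromℕ j ^ n * 1/! j)
    ≡⟨ ∑-cong N expand ⟩
  ∑[ j < N ] ∑[ k < suc n ] (S n k * (F j k * 1/! j))
    ≡⟨ ∑-swap N (suc n) _ ⟩
  ∑[ k < suc n ] ∑[ j < N ] (S n k * (F j k * 1/! j))
    ≡⟨ ∑-cong< (suc n) (λ k k≤n → trans (∑-*ˡ N (S n k) _) (cong (S n k *_) (inner k (ℕ.≤-trans (ℕ.≤-pred k≤n) n≤N)))) ⟩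
  ∑[ k < suc n ] (S n k * seq e (N ∸ k)) ∎
  where
  open ≡-Reasoning
  F : ℕ → ℕ → ℚ
  F j = fallingFactorial (fromℕ j)

  expand : ∀ j → fromℕ j ^ n * 1/! j ≡ ∑[ k < suc n ] (S n k * (F j k * 1/! j))
  expand j = begin
    fromℕ j ^ n * 1/! j
      ≡⟨ cong (_* 1/! j) (^-fallingFactorial (fromℕ j) n) ⟩
    ∑[ k < suc n ] (S n k * F j k) * 1/! j
      ≡⟨ *-comm _ (1/! j) ⟩
    1/! j * ∑[ k < suc n ] (S n k * F j k)
      ≡⟨ sym (∑-*ˡ (suc n) (1/! j) _) ⟩
    ∑[ k < suc n ] (1/! j * (S n k * F j k))
      ≡⟨ ∑-cong (suc n) (λ k → solve 3 (λ f s x → f :* (s :* x) := s :* (x :* f)) refl (1/! j) (S n k) (F j k)) ⟩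
    ∑[ k < suc n ] (S n k * (F j k * 1/! j)) ∎

  inner : ∀ k → k ℕ.≤ N → ∑[ j < N ] (F j k * 1/! j) ≡ seq e (N ∸ k)
  inner k k≤N = trans (cong (λ M → ∑[ j < M ] (F j k * 1/! j)) (sym (ℕ.m+[n∸m]≡n k≤N)))
    (fallingFactorial-series k (N ∸ k))

-- Kummer's function

-- Dividing by a power of -1 is multiplying by it.
-1^-∸ : ∀ {k n} → k ℕ.≤ n → (- 1ℚ) ^ (n ∸ k) ≡ (- 1ℚ) ^ n * (- 1ℚ) ^ k
-1^-∸ z≤n       = sym (*-identityʳ _)
-1^-∸ (s≤s {k} {n} k≤n) = trans (-1^-∸ k≤n)
  (solve 2 (λ a b → a :* b := con (- 1ℚ) :* a :* (con (- 1ℚ) :* b)) refl ((- 1ℚ) ^ n) ((- 1ℚ) ^ k))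

neg-^ : ∀ x n → (- x) ^ n ≡ (- 1ℚ) ^ n * x ^ n
neg-^ x zero    = refl
neg-^ x (suc n) = trans (cong (- x *_) (neg-^ x n))
  (solve 3 (λ x s p → :- x :* (s :* p) := con (- 1ℚ) :* s :* (x :* p)) refl x ((- 1ℚ) ^ n) (x ^ n))

-1^-square : ∀ n → (- 1ℚ) ^ n * (- 1ℚ) ^ n ≡ 1ℚ
-1^-square zero    = refl
-1^-square (suc n) = trans
  (solve 1 (λ s → con (- 1ℚ) :* s :* (con (- 1ℚ) :* s) := s :* s) refl ((- 1ℚ) ^ n)) (-1^-square n)

1^ : ∀ n → 1ℚ ^ n ≡ 1ℚ
1^ zero    = refl
1^ (suc n) = trans (*-identityˡ (1ℚ ^ n)) (1^ n)

-- The falling factorial expansion at -x: the reflection of the k-th falling factorial contributes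
-- (-1)^k, which combines with (-1)^n.
^-pochhammer : ∀ x n → x ^ n ≡ ∑[ k < suc n ] ((- 1ℚ) ^ (n ∸ k) * S n k * pochhammer x k)
^-pochhammer x n = begin
  x ^ n
    ≡⟨ sym (*-identityˡ (x ^ n)) ⟩
  1ℚ * x ^ n
    ≡⟨ cong (_* x ^ n) (sym (-1^-square n)) ⟩
  σ * σ * x ^ n
    ≡⟨ *-assoc σ σ (x ^ n) ⟩
  σ * (σ * x ^ n)
    ≡⟨ cong (σ *_) (trans (sym (neg-^ x n)) (^-fallingFactorial (- x) n)) ⟩
  σ * ∑[ k < suc n ] (S n k * fallingFactorial (- x) k)
    ≡⟨ sym (∑-*ˡ (suc n) σ _) ⟩
  ∑[ k < suc n ] (σ * (S n k * fallingFactorial (- x) k))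
    ≡⟨ ∑-cong< (suc n) (λ k k≤n → trans
         (cong (λ w → σ * (S n k * w)) (fallingFactorial-neg x k))
         (trans (solve 4 (λ a s b p → a :* (s :* (b :* p)) := a :* b :* s :* p) refl σ (S n k) ((- 1ℚ) ^ k) (pochhammer x k))
           (cong (λ w → w * S n k * pochhammer x k) (sym (-1^-∸ (ℕ.≤-pred k≤n)))))) ⟩
  ∑[ k < suc n ] ((- 1ℚ) ^ (n ∸ k) * S n k * pochhammer x k) ∎
  where
  open ≡-Reasoning
  σ = (- 1ℚ) ^ n

!-pochhammer : ∀ k m → fromℕ (k !) * pochhammer (fromℕ (suc k)) m ≡ fromℕ ((m ℕ.+ k) !)
!-pochhammer k zero    = *-identityʳ (fromℕ (k !))
!-pochhammer k (suc m) = begin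
  fromℕ (k !) * (P * (fromℕ (suc k) + fromℕ m))
    ≡⟨ sym (*-assoc (fromℕ (k !)) P _) ⟩
  fromℕ (k !) * P * (fromℕ (suc k) + fromℕ m)
    ≡⟨ cong₂ _*_ (!-pochhammer k m)
         (trans (sym (fromℕ-+ (suc k) m)) (cong (λ j → fromℕ (suc j)) (ℕ.+-comm k m))) ⟩
  fromℕ ((m ℕ.+ k) !) * fromℕ (suc (m ℕ.+ k))
    ≡⟨ *-comm (fromℕ ((m ℕ.+ k) !)) (fromℕ (suc (m ℕ.+ k))) ⟩
  fromℕ (suc (m ℕ.+ k)) * fromℕ ((m ℕ.+ k) !)
    ≡⟨ sym (fromℕ-* (suc (m ℕ.+ k)) ((m ℕ.+ k) !)) ⟩
  fromℕ (suc (m ℕ.+ k) !) ∎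
  where
  open ≡-Reasoning
  P = pochhammer (fromℕ (suc k)) m

-- k! (k + 1)_m = (k + m)! = m! (m + 1)_k
₁F₁-term-k+1-2-1 : ∀ k m → fromℕ (k !) * ₁F₁-term (fromℕ (k ℕ.+ 1)) (fromℕ 2) 1ℚ m ≡
  pochhammer (fromℕ (suc m)) k * 1/! suc m
₁F₁-term-k+1-2-1 k m = begin
  fromℕ (k !) * (Q * (1ℚ ^ m * 1/! m))
    ≡⟨ cong₂ (λ u v → fromℕ (k !) * (u * (v * 1/! m))) Q≡ (1^ m) ⟩
  fromℕ (k !) * (A * 1/! suc m * (1ℚ * 1/! m))
    ≡⟨ solve 4 (λ k a u v → k :* (a :* u :* (con 1ℚ :* v)) := k :* a :* (u :* v)) refl
         (fromℕ (k !)) A (1/! suc m) (1/! m) ⟩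
  fromℕ (k !) * A * (1/! suc m * 1/! m)
    ≡⟨ cong (_* (1/! suc m * 1/! m)) k!A ⟩
  fromℕ (m !) * pochhammer (fromℕ (suc m)) k * (1/! suc m * 1/! m)
    ≡⟨ solve 4 (λ f p u v → f :* p :* (u :* v) := v :* f :* (p :* u)) refl
         (fromℕ (m !)) (pochhammer (fromℕ (suc m)) k) (1/! suc m) (1/! m) ⟩
  1/! m * fromℕ (m !) * (pochhammer (fromℕ (suc m)) k * 1/! suc m)
    ≡⟨ cong (_* (pochhammer (fromℕ (suc m)) k * 1/! suc m)) (1/!*! m) ⟩
  1ℚ * (pochhammer (fromℕ (suc m)) k * 1/! suc m)
    ≡⟨ *-identityˡ _ ⟩
  pochhammer (fromℕ (suc m)) k * 1/! suc m ∎
  where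
  open ≡-Reasoning
  A = pochhammer (fromℕ (k ℕ.+ 1)) m
  P = pochhammer (fromℕ 2) m
  instance
    P≢0 = pochhammer-nonZero (fromℕ 2) m
  Q = A ÷ P

  P≡ : P ≡ fromℕ (suc m !)
  -- The case k = 1 of `!-pochhammer`, whose factor `1 !` evaluates to 1.
  P≡ = trans (sym (*-identityˡ P)) (trans (!-pochhammer 1 m) (cong (λ j → fromℕ (j !)) (ℕ.+-comm m 1)))

  Q≡ : Q ≡ A * 1/! suc m
  Q≡ = begin
    Q                                      ≡⟨ sym (*-identityʳ Q) ⟩
    Q * 1ℚ                                 ≡⟨ cong (Q *_) (sym (1/!*! (suc m))) ⟩
    Q * (1/! suc m * fromℕ (suc m !))      ≡⟨ cong (λ w → Q * (1/! suc m * w)) (sym P≡) ⟩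
    Q * (1/! suc m * P)                    ≡⟨ solve 3 (λ q u p → q :* (u :* p) := q :* p :* u) refl Q (1/! suc m) P ⟩
    Q * P * 1/! suc m                      ≡⟨ cong (_* 1/! suc m) (÷-* A P) ⟩
    A * 1/! suc m                          ∎

  k!A : fromℕ (k !) * A ≡ fromℕ (m !) * pochhammer (fromℕ (suc m)) k
  k!A = begin
    fromℕ (k !) * A                                  ≡⟨ cong (λ j → fromℕ (k !) * pochhammer (fromℕ j) m) (ℕ.+-comm k 1) ⟩
    fromℕ (k !) * pochhammer (fromℕ (suc k)) m       ≡⟨ !-pochhammer k m ⟩
    fromℕ ((m ℕ.+ k) !)                              ≡⟨ cong (λ j → fromℕ (j !)) (ℕ.+-comm m k) ⟩
    fromℕ ((k ℕ.+ m) !)                              ≡⟨ sym (!-pochhammer m k) ⟩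
    fromℕ (m !) * pochhammer (fromℕ (suc m)) k       ∎

-- For fixed m, the dependence on k is through the rising factorial of m + 1 alone, so
-- `^-pochhammer` at x = m + 1 collapses the sum.
Kummer-term-sum : ∀ n m →
  ∑[ k < suc n ] ((- 1ℚ) ^ (n ∸ k) * S n k * fromℕ (k !) * ₁F₁-term (fromℕ (k ℕ.+ 1)) (fromℕ 2) 1ℚ m) ≡
  fromℕ (suc m) ^ n * 1/! suc m
Kummer-term-sum n m = begin
  ∑[ k < suc n ] (c k * fromℕ (k !) * t k)
    ≡⟨ ∑-cong (suc n) (λ k → trans (*-assoc (c k) (fromℕ (k !)) (t k))
         (trans (cong (c k *_) (₁F₁-term-k+1-2-1 k m))
           (solve 3 (λ c p u → c :* (p :* u) := u :* (c :* p)) refl (c k) (pochhammer x k) (1/! suc m)))) ⟩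
  ∑[ k < suc n ] (1/! suc m * (c k * pochhammer x k))
    ≡⟨ ∑-*ˡ (suc n) (1/! suc m) _ ⟩
  1/! suc m * ∑[ k < suc n ] (c k * pochhammer x k)
    ≡⟨ cong (1/! suc m *_) (sym (^-pochhammer x n)) ⟩
  1/! suc m * x ^ n
    ≡⟨ *-comm (1/! suc m) (x ^ n) ⟩
  x ^ n * 1/! suc m ∎
  where
  open ≡-Reasoning
  x = fromℕ (suc m)
  c t : ℕ → ℚ
  c k = (- 1ℚ) ^ (n ∸ k) * S n k
  t k = ₁F₁-term (fromℕ (k ℕ.+ 1)) (fromℕ 2) 1ℚ m

seq-∑ᴿ : ∀ n f N → seq (∑ᴿ n f) N ≡ ∑[ k < n ] seq (f (suc k)) N
seq-∑ᴿ zero    f N = refl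
seq-∑ᴿ (suc n) f N = cong (_+ seq (f (suc n)) N) (seq-∑ᴿ n f N)

-- All series are cut off at the same N, so the exchange of sums is finite. The substitution j = m +
-- 1 turns N terms into the terms from 1 to N.
seq-Kummer-sum : ∀ n .{{_ : NonZero n}} N →
  seq (∑ᴿ[ 1≤ k ≤ n ] (fromℚ ((- 1ℚ) ^ (n ∸ k) * S n k * fromℕ (k !)) *ᴿ
                       ₁F₁ (fromℕ (k ℕ.+ 1)) (fromℕ 2) 1ℚ)) N ≡
  ∑[ j < suc N ] (fromℕ j ^ n * 1/! j)
seq-Kummer-sum n@(suc n-1) N = begin
  _
    ≡⟨ seq-∑ᴿ n _ N ⟩
  ∑[ k < n ] (c (suc k) * ∑[ m < N ] t (suc k) m)
    ≡⟨ ∑-cong n (λ k → sym (∑-*ˡ N (c (suc k)) (t (suc k)))) ⟩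
  ∑[ k < n ] ∑[ m < N ] (c (suc k) * t (suc k) m)
    ≡⟨ ∑-swap n N _ ⟩
  ∑[ m < N ] ∑[ k < n ] (c (suc k) * t (suc k) m)
    ≡⟨ ∑-cong N column ⟩
  ∑[ m < N ] (fromℕ (suc m) ^ n * 1/! suc m)
    ≡⟨ sym (+-identityˡ _) ⟩
  0ℚ + ∑[ m < N ] (fromℕ (suc m) ^ n * 1/! suc m)
    ≡⟨ cong (_+ ∑[ m < N ] (fromℕ (suc m) ^ n * 1/! suc m))
         -- The term at j = 0 can be added because `n` is a successor, which makes `0ℚ ^ n` zero.
         (solve 1 (λ z → con 0ℚ := con 0ℚ :* z :* con 1ℚ) refl (0ℚ ^ n-1)) ⟩
  0ℚ ^ n * 1ℚ + ∑[ m < N ] (fromℕ (suc m) ^ n * 1/! suc m)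
    ≡⟨ sym (∑-suc N _) ⟩
  ∑[ j < suc N ] (fromℕ j ^ n * 1/! j) ∎
  where
  open ≡-Reasoning
  c : ℕ → ℚ
  c k = (- 1ℚ) ^ (n ∸ k) * S n k * fromℕ (k !)
  t : ℕ → ℕ → ℚ
  t k = ₁F₁-term (fromℕ (k ℕ.+ 1)) (fromℕ 2) 1ℚ

  column : ∀ m → ∑[ k < n ] (c (suc k) * t (suc k) m) ≡ fromℕ (suc m) ^ n * 1/! suc m
  column m = begin
    ∑[ k < n ] (c (suc k) * t (suc k) m)
      ≡⟨ sym (+-identityˡ _) ⟩
    0ℚ + ∑[ k < n ] (c (suc k) * t (suc k) m)
      ≡⟨ cong (_+ ∑[ k < n ] (c (suc k) * t (suc k) m))
           -- The term at k = 0 can be added because `S n 0` vanishes for positive `n`.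
           (sym (trans (cong (λ s → (- 1ℚ) ^ n * s * 1ℚ * t 0 m) (S-suc-zero n-1))
             (solve 2 (λ s u → s :* con 0ℚ :* con 1ℚ :* u := con 0ℚ) refl ((- 1ℚ) ^ n) (t 0 m)))) ⟩
    c 0 * t 0 m + ∑[ k < n ] (c (suc k) * t (suc k) m)
      ≡⟨ sym (∑-suc n _) ⟩
    ∑[ k < suc n ] (c k * t k m)
      ≡⟨ Kummer-term-sum n m ⟩
    fromℕ (suc m) ^ n * 1/! suc m ∎

-- Null sequences

Null : (ℕ → ℚ) → Set
Null x = ∀ ε → 0ℚ < ε → ∃[ N ] (∀ n → N ℕ.≤ n → ∣ x n ∣ < ε)

null-dominated : ∀ {x y} b M → (∀ n → M ℕ.≤ n → ∣ x n ∣ ≤ fromℕ b * ∣ y n ∣) → Null y → Null x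
null-dominated {x} {y} b M x≤by y→0 ε 0<ε =
  -- `small` gives only a weak inequality; aiming at half of `ε` leaves room for the strict one.
  let δ , 0<δ , bδ≤½ε = small b (0<½ε 0<ε)
      N , y<δ = y→0 δ 0<δ
  in M ℕ.⊔ N , λ n n≥ → begin-strict
    ∣ x n ∣            ≤⟨ x≤by n (⊔-left n≥) ⟩
    fromℕ b * ∣ y n ∣  ≤⟨ *-monoˡ-≤-nonNeg (fromℕ b) (<⇒≤ (y<δ n (⊔-right {M} n≥))) ⟩
    fromℕ b * δ        ≤⟨ bδ≤½ε ⟩
    ½ * ε              ≡⟨ sym (+-identityʳ (½ * ε)) ⟩
    ½ * ε + 0ℚ         <⟨ +-monoʳ-< (½ * ε) (0<½ε 0<ε) ⟩
    ½ * ε + ½ * ε      ≡⟨ ½ε+½ε ε ⟩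
    ε                  ∎
  where open ≤-Reasoning

null-+ : ∀ {x y} → Null x → Null y → Null (λ n → x n + y n)
null-+ {x} {y} x→0 y→0 ε 0<ε =
  let M , x<½ε = x→0 (½ * ε) (0<½ε 0<ε)
      N , y<½ε = y→0 (½ * ε) (0<½ε 0<ε)
  in M ℕ.⊔ N , λ n n≥ → begin-strict
    ∣ x n + y n ∣      ≤⟨ ∣p+q∣≤∣p∣+∣q∣ (x n) (y n) ⟩
    ∣ x n ∣ + ∣ y n ∣  <⟨ +-mono-< (x<½ε n (⊔-left n≥)) (y<½ε n (⊔-right {M} n≥)) ⟩
    ½ * ε + ½ * ε      ≡⟨ ½ε+½ε ε ⟩
    ε                  ∎
  where open ≤-Reasoning

null-*ˡ : ∀ c {x} → Null x → Null (λ n → c * x n)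
null-*ˡ c {x} = let b , ∣c∣<b = archimedean ∣ c ∣ in null-dominated b 0 λ n _ → begin
  ∣ c * x n ∣        ≡⟨ ∣p*q∣≡∣p∣*∣q∣ c (x n) ⟩
  ∣ c ∣ * ∣ x n ∣    ≤⟨ *-monoʳ-≤-nonNeg ∣ x n ∣ {{∣-∣-nonNeg (x n)}} (<⇒≤ ∣c∣<b) ⟩
  fromℕ b * ∣ x n ∣  ∎
  where open ≤-Reasoning

null-∑ : ∀ m {f : ℕ → ℕ → ℚ} → (∀ k → Null (f k)) → Null (λ n → ∑[ k < m ] f k n)
null-∑ zero    f→0 ε 0<ε = 0 , λ _ _ → 0<ε
null-∑ (suc m) f→0 = null-+ (null-∑ m f→0) (f→0 m)

-- The shifted index is the one that `Dobinski-partialSum` produces at `suc n`.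
cauchy-shift : ∀ x k → Null (λ n → seq x n - seq x (suc n ∸ k))
cauchy-shift x k ε 0<ε =
  let N , close = cauchy x ε 0<ε
  -- The added `k` keeps the shifted index at or above `N`.
  in k ℕ.+ N , λ n n≥ → close n (suc n ∸ k) (ℕ.≤-trans (ℕ.m≤n+m N k) n≥)
       (subst (ℕ._≤ suc n ∸ k) (ℕ.m+n∸m≡n k N) (ℕ.∸-monoˡ-≤ k (ℕ.m≤n⇒m≤1+n n≥)))

∣1/₀∣≤1 : ∀ {q} → 1ℚ ≤ ∣ q ∣ → ∣ 1/₀ q ∣ ≤ 1ℚ
∣1/₀∣≤1 {q} 1≤∣q∣ = begin
  ∣ 1/₀ q ∣          ≡⟨ sym (*-identityʳ _) ⟩
  ∣ 1/₀ q ∣ * 1ℚ     ≤⟨ *-monoˡ-≤-nonNeg ∣ 1/₀ q ∣ {{∣-∣-nonNeg (1/₀ q)}} 1≤∣q∣ ⟩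
  ∣ 1/₀ q ∣ * ∣ q ∣  ≡⟨ sym (∣p*q∣≡∣p∣*∣q∣ (1/₀ q) q) ⟩
  ∣ 1/₀ q * q ∣      ≡⟨ cong ∣_∣ (1/₀-inverse q (<-≤-trans (positive⁻¹ 1ℚ) 1≤∣q∣)) ⟩
  1ℚ                 ∎
  where open ≤-Reasoning

-- Passage to the limit

Dobinski : ∀ n {s : ℕ → ℚ} → (∀ N → s N ≡ ∑[ j < suc N ] (fromℕ j ^ n * 1/! j)) →
  Null (λ N → B n - 1/₀ seq e N * s N)
-- The constant 1 bounds the reciprocals, as the partial sums of `e` are at least 1 from index 1 on.
-- The threshold n + 1 secures this and the bound in `Dobinski-partialSum`.
Dobinski n {s} s≡ = null-dominated {λ N → B n - 1/₀ seq e N * s N} {gap} 1 (suc n) error≤ gap→0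
  where
  1≤∣e∣ : ∀ N → suc n ℕ.≤ N → 1ℚ ≤ ∣ seq e N ∣
  1≤∣e∣ N n<N = proj₂ (proj₂ (proj₂ e-nonZero)) N (ℕ.≤-trans (s≤s z≤n) n<N)

  gap : ℕ → ℚ
  gap N = ∑[ k < suc n ] (S n k * (seq e N - seq e (suc N ∸ k)))

  gap→0 : Null gap
  gap→0 = null-∑ (suc n) {λ k N → S n k * (seq e N - seq e (suc N ∸ k))}
    λ k → null-*ˡ (S n k) {λ N → seq e N - seq e (suc N ∸ k)} (cauchy-shift e k)

  error : ∀ N → suc n ℕ.≤ N → B n - 1/₀ seq e N * s N ≡ 1/₀ seq e N * gap N
  error N n<N = begin
    B n - i * s N
      ≡⟨ cong₂ (λ u v → u - i * v) (B-S n)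
           (trans (s≡ N) (Dobinski-partialSum n (suc N) (ℕ.m≤n⇒m≤1+n (ℕ.<⇒≤ n<N)))) ⟩
    b - i * d
      ≡⟨ cong (_- i * d) (sym (*-identityˡ b)) ⟩
    1ℚ * b - i * d
      -- `1/₀` is a true inverse here because E is bounded away from 0.
      ≡⟨ cong (λ w → w * b - i * d) (sym (1/₀-inverse E (<-≤-trans (positive⁻¹ 1ℚ) (1≤∣e∣ N n<N)))) ⟩
    i * E * b - i * d
      -- The subtraction becomes a factor -1 so that `∑-+` and `∑-*ˡ` can assemble `gap N`.
      ≡⟨ solve 4 (λ i E s d → i :* E :* s :- i :* d := i :* (E :* s :+ con (- 1ℚ) :* d)) refl i E b d ⟩
    i * (E * b + - 1ℚ * d)
      ≡⟨ cong (i *_) (sym (trans (∑-cong (suc n) λ k →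
             solve 3 (λ s x y → s :* (x :- y) := x :* s :+ con (- 1ℚ) :* (s :* y)) refl (S n k) E (seq e (suc N ∸ k)))
           (trans (∑-+ (suc n) _ _) (cong₂ _+_ (∑-*ˡ (suc n) E _) (∑-*ˡ (suc n) (- 1ℚ) _))))) ⟩
    i * gap N ∎
    where
    open ≡-Reasoning
    E = seq e N
    i = 1/₀ E
    b = ∑[ k < suc n ] S n k
    d = ∑[ k < suc n ] (S n k * seq e (suc N ∸ k))

  error≤ : ∀ N → suc n ℕ.≤ N → ∣ B n - 1/₀ seq e N * s N ∣ ≤ 1ℚ * ∣ gap N ∣
  error≤ N n<N = begin
    ∣ B n - 1/₀ seq e N * s N ∣  ≡⟨ cong ∣_∣ (error N n<N) ⟩
    ∣ 1/₀ seq e N * gap N ∣                       ≡⟨ ∣p*q∣≡∣p∣*∣q∣ (1/₀ seq e N) (gap N) ⟩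
    ∣ 1/₀ seq e N ∣ * ∣ gap N ∣                   ≤⟨ *-monoʳ-≤-nonNeg ∣ gap N ∣ {{∣-∣-nonNeg (gap N)}} (∣1/₀∣≤1 (1≤∣e∣ N n<N)) ⟩
    1ℚ * ∣ gap N ∣                                ∎
    where open ≤-Reasoning

theorem1p1 : (n : ℕ) .{{_ : NonZero n}} →
    fromℚ (B n) ≃ᴿ
      1/ᴿ e e-nonZero *ᴿ
        ∑ᴿ[ 1≤ k ≤ n ] (fromℚ ((- 1ℚ) ^ (n ∸ k) * S n k * fromℕ (k !)) *ᴿ
                        ₁F₁ (fromℕ (k ℕ.+ 1)) (fromℕ 2) 1ℚ)
-- x ≃ᴿ y unfolds to the statement that seq x - seq y is null.
theorem1p1 n = Dobinski n (seq-Kummer-sum n)
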